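{- If there is some $\epsilon>0$ such that $4$-SUM can be solved in time $O(n^{\frac43-\epsilon})$, then the $3$-uniform hyperclique hypothesis fails.
   Context: $4$-SUM: given sets $A_1,A_2,A_3,A_4$ of $n$ integers each, decide whether there exist $a_i\in A_i$ with $a_1+a_2+a_3+a_4=0$. All input numbers lie in a polynomially sized universe $\{ -U,\dots,U\}$ with $U\le n^{c}$ for some constant $c$. $3$-uniform hyperclique hypothesis: for every fixed $k\ge 4$ and every $\epsilon>0$, there is no $O(n^{k-\epsilon})$-time algorithm that, given a $3$-uniform hypergraph on $n$ vertices, decides whether it contains a $k$-hyperclique, i.e. a set of $k$ vertices all of whose $3$-element subsets are hyperedges. -}

module Defs where

open import Data.Bool.Base using (Bool; true; if_then_else_)
open import Data.Fin.Base using (Fin; zero; suc)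
open import Data.Fin.Subset using (Subset; ⁅_⁆; _∪_; _⊆_) renaming (∣_∣ to card)
open import Data.Integer.Base as ℤ using (ℤ; +_; -[1+_]; +[1+_]; 0ℤ; 1ℤ; ∣_∣)
import Data.Integer.Properties as ℤ
open import Data.List.Base using (List; _∷_; concat; tabulate; drop; head)
open import Data.Maybe.Base using (fromMaybe)
open import Data.Nat.Base as ℕ using (ℕ; zero; suc; _≤_; _^_)
import Data.Nat.Properties as ℕ
open import Data.Product.Base using (Σ-syntax; ∃-syntax; _×_)
open import Data.Rational.Unnormalised.Base as ℚ using (ℚᵘ; 0ℚᵘ; ↥_; ↧ₙ_)
open import Function.Base using (_∘_)
open import Function.Bundles using (_⇔_)
open import Function.Definitions using (Injective)
open import Relation.Binary.Definitions using (DecidableEquality)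
open import Relation.Binary.PropositionalEquality using (_≡_; _≢_)
open import Relation.Nullary.Decidable using (does)
open import Relation.Nullary.Negation using (¬_)

------------------------------------------------------------------------
-- Word RAM
--
-- A deterministic unit-cost RAM with registers, random-access memory and a
-- read-only random-access input, all holding integers.  Words have O(log n)
-- bits: on inputs of size n every computed value must be at most (n + 2) ^ d
-- in absolute value, for a constant d belonging to the algorithm (see
-- `Solvable`).  Instruction sets with bitwise operations differ only by
-- polylogarithmic factors, which do not affect the existence of an ε > 0.

Reg : Set
Reg = ℕ

data Op : Set where
  add sub mul div mod lt : Op

data Rhs : Set where
  const : ℤ → Rhs
  arith : Op → Reg → Reg → Rhs
  load  : Reg → Rhs
  input : Reg → Rhs

infixr 5 _⨾_
infix  6 _≔_

data Program : Set where
  skip        : Program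
  _≔_         : Reg → Rhs → Program
  store[_]_   : Reg → Reg → Program
  _⨾_         : Program → Program → Program
  if_≢0_else_ : Reg → Program → Program → Program
  while_≢0_   : Reg → Program → Program

evalOp : Op → ℤ → ℤ → ℤ
evalOp add x y = x ℤ.+ y
evalOp sub x y = x ℤ.- y
evalOp mul x y = x ℤ.* y
-- Division and remainder by zero give 0.
evalOp div x (+ zero)     = 0ℤ
evalOp div x y@(+[1+ _ ]) = x ℤ./ y
evalOp div x y@(-[1+ _ ]) = x ℤ./ y
evalOp mod x (+ zero)     = 0ℤ
evalOp mod x y@(+[1+ _ ]) = + (x ℤ.% y)
evalOp mod x y@(-[1+ _ ]) = + (x ℤ.% y)
evalOp lt  x y = if does (x ℤ.<? y) then 1ℤ else 0ℤ

record State : Set where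
  constructor ⟪_,_⟫
  field
    regs : Reg → ℤ
    mem  : ℤ → ℤ
open State public

initial : State
initial = ⟪ (λ _ → 0ℤ) , (λ _ → 0ℤ) ⟫

update : {A : Set} → DecidableEquality A → (A → ℤ) → A → ℤ → A → ℤ
update _≟_ f a v x = if does (x ≟ a) then v else f x

setReg : State → Reg → ℤ → State
setReg σ r v = record σ { regs = update ℕ._≟_ (regs σ) r v }

setMem : State → ℤ → ℤ → State
setMem σ a v = record σ { mem = update ℤ._≟_ (mem σ) a v }

-- Cells outside the input read as 0.
cell : List ℤ → ℤ → ℤ
cell xs (+ i)    = fromMaybe 0ℤ (head (drop i xs))
cell xs -[1+ _ ] = 0ℤ

eval : List ℤ → State → Rhs → ℤ
eval inp σ (const v)     = v
eval inp σ (arith o r s) = evalOp o (regs σ r) (regs σ s)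
eval inp σ (load r)      = mem σ (regs σ r)
eval inp σ (input r)     = cell inp (regs σ r)

-- Run W inp p σ t σ′: started in σ on input inp, p halts in state σ′ after
-- t steps, and no computed value exceeds W in absolute value.
data Run (W : ℕ) (inp : List ℤ) : Program → State → ℕ → State → Set where
  run-skip   : ∀ {σ} → Run W inp skip σ 1 σ
  run-assign : ∀ {r e σ} → ∣ eval inp σ e ∣ ≤ W →
               Run W inp (r ≔ e) σ 1 (setReg σ r (eval inp σ e))
  run-store  : ∀ {r s σ} →
               Run W inp (store[ r ] s) σ 1 (setMem σ (regs σ r) (regs σ s))
  run-seq    : ∀ {p q σ σ′ σ″ t u} →
               Run W inp p σ t σ′ → Run W inp q σ′ u σ″ →
               Run W inp (p ⨾ q) σ (t ℕ.+ u) σ″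
  run-then   : ∀ {r p q σ σ′ t} → regs σ r ≢ 0ℤ → Run W inp p σ t σ′ →
               Run W inp (if r ≢0 p else q) σ (suc t) σ′
  run-else   : ∀ {r p q σ σ′ t} → regs σ r ≡ 0ℤ → Run W inp q σ t σ′ →
               Run W inp (if r ≢0 p else q) σ (suc t) σ′
  run-exit   : ∀ {r p σ} → regs σ r ≡ 0ℤ →
               Run W inp (while r ≢0 p) σ 1 σ
  run-loop   : ∀ {r p σ σ′ σ″ t u} → regs σ r ≢ 0ℤ →
               Run W inp p σ t σ′ → Run W inp (while r ≢0 p) σ′ u σ″ →
               Run W inp (while r ≢0 p) σ (suc (t ℕ.+ u)) σ″

------------------------------------------------------------------------
-- Decision problems and running times

record Problem : Set₁ where
  field
    Instance : ℕ → Set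
    encode   : ∀ {n} → Instance n → List ℤ
    Yes      : ∀ {n} → Instance n → Set

-- For r = p / q with q > 0: t ≤ c · n ^ r with c ^ q = C, raised to the
-- q-th power and with a negative exponent moved to the left-hand side.
TimeBound : ℕ → ℕ → ℚᵘ → ℕ → Set
TimeBound C n r t with ↥ r
... | + p      = t ^ ↧ₙ r ≤ C ℕ.* n ^ p
... | -[1+ p ] = t ^ ↧ₙ r ℕ.* n ^ suc p ≤ C

-- P has an O(n ^ r)-time algorithm.  It answers "yes" by halting with 1 in
-- register 0; it must halt with a correct answer on every instance, while
-- the running time is only bounded from some n₀ on.
Solvable : Problem → ℚᵘ → Set
Solvable P r =
  Σ[ p ∈ Program ] ∃[ d ] ∃[ C ] ∃[ n₀ ]
    (∀ n (I : Instance n) →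
      Σ[ t ∈ ℕ ] Σ[ σ ∈ State ]
        Run ((n ℕ.+ 2) ^ d) (encode I) p initial t σ
        × (regs σ 0 ≡ 1ℤ ⇔ Yes I)
        × (n₀ ≤ n → TimeBound C n r t))
  where open Problem P

------------------------------------------------------------------------
-- 4-SUM

-- An n-element set is given by an injective enumeration.
record FourSumInstance (c n : ℕ) : Set where
  field
    A         : Fin 4 → Fin n → ℤ
    injective : ∀ i → Injective _≡_ _≡_ (A i)
    bounded   : ∀ i j → ∣ A i j ∣ ≤ n ^ c

FourSum : ℕ → Problem
FourSum c = record
  { Instance = FourSumInstance c
  ; encode   = λ {n} I → + n ∷ concat (tabulate (tabulate ∘ A I))
  ; Yes      = λ I → ∃[ j₁ ] ∃[ j₂ ] ∃[ j₃ ] ∃[ j₄ ]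
      A I zero j₁ ℤ.+ A I (suc zero) j₂
        ℤ.+ A I (suc (suc zero)) j₃ ℤ.+ A I (suc (suc (suc zero))) j₄ ≡ 0ℤ
  }
  where open FourSumInstance

------------------------------------------------------------------------
-- Hypercliques in 3-uniform hypergraphs

record Hypergraph₃ (n : ℕ) : Set where
  field
    edge    : Subset n → Bool
    uniform : ∀ e → edge e ≡ true → card e ≡ 3
open Hypergraph₃ public

IsHyperclique : ∀ {n} → Hypergraph₃ n → Subset n → Set
IsHyperclique H S = ∀ e → e ⊆ S → card e ≡ 3 → edge H e ≡ true

-- The input is the number of vertices followed by the n × n × n adjacency
-- tensor, whose entry at x, y, z tells whether {x , y , z} is an edge.
encodeHypergraph : ∀ {n} → Hypergraph₃ n → List ℤ
encodeHypergraph {n} H =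
  + n ∷ concat (tabulate λ x → concat (tabulate λ y → tabulate λ z →
    if edge H (⁅ x ⁆ ∪ ⁅ y ⁆ ∪ ⁅ z ⁆) then 1ℤ else 0ℤ))

Hyperclique : ℕ → Problem
Hyperclique k = record
  { Instance = Hypergraph₃
  ; encode   = encodeHypergraph
  ; Yes      = λ {n} H → Σ[ S ∈ Subset n ] card S ≡ k × IsHyperclique H S
  }

-- A rational ε suffices: n ^ (k - ε) decreases in ε, for n ≥ 1.
HypercliqueHypothesis : Set
HypercliqueHypothesis =
  ∀ k → 4 ≤ k → ∀ ε → 0ℚᵘ ℚ.< ε →
  ¬ Solvable (Hyperclique k) (+ k ℚ./ 1 ℚ.- ε)

{-# OPTIONS --safe #-}

-- Already k = 4 works.  A 4-hyperclique {a , b , c , d} is a choice of four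
-- edges bcd, acd, abd, abc that agree on the common vertices, so on n vertices
-- let set i of the 4-SUM instance consist of N = n³ numbers, one for each
-- triple that could be opposite to the i-th vertex.  Their base-n digits check
-- the agreement and a least significant flag marks the triples that are not
-- edges.  Each word of this instance is computable in constant time from the
-- adjacency tensor, so a 4-SUM algorithm can run on it without the instance
-- ever being written down, in time O(N ^ (4/3 - ε)) = O(n ^ (4 - 3 ε)).
module Submission where

open import Defs
open import Data.Bool.Base using (Bool; true; false; if_then_else_)
open import Data.Fin.Base as Fin
  using (Fin; zero; suc; toℕ; fromℕ<; combine; remQuot; punchIn; punchOut)
open import Data.Fin.Patterns
import Data.Fin.Properties as Fin
open import Data.Fin.Subset
  using (Subset; ⁅_⁆; _∪_; _⊆_; _∈_; _∉_; ⊥; inside; outside) renaming (∣_∣ to card)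
import Data.Fin.Subset.Properties as Subset
open import Data.Integer.Base using (+_)
open import Data.Integer.Base as ℤ using (ℤ; -[1+_]; +[1+_]; 0ℤ; 1ℤ; ∣_∣)
import Data.Integer.DivMod as ℤ
import Data.Integer.Properties as ℤ
open import Data.Integer.Tactic.RingSolver using (solve-∀)
open import Data.List.Base using (List; []; _∷_; _++_; concat; tabulate; length)
import Data.List.Properties as List
open import Data.List.Relation.Unary.All using (All; []; _∷_)
import Data.List.Relation.Unary.All.Properties as All
open import Data.Nat.Base as ℕ using (ℕ; zero; suc; _+_; _*_; _⊔_; _≤_; _^_; z≤n; s≤s)
import Data.Nat.Divisibility as ℕ
import Data.Nat.DivMod as ℕ
import Data.Nat.Properties as ℕ
open import Data.Product.Base using (Σ-syntax; ∃-syntax; _×_; _,_; proj₁; proj₂; uncurry)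
open import Data.Rational.Unnormalised.Base using (0ℚᵘ; _<_; _/_; _-_)
open import Data.Rational.Unnormalised.Base using (ℚᵘ; mkℚᵘ; *<*; ↥_; ↧ₙ_)
import Data.Rational.Unnormalised.Properties as ℚ
open import Data.Sum.Base using (_⊎_; inj₁; inj₂)
open import Data.Vec.Base using ([]; _∷_; lookup)
open import Function.Base using (_∘_)
open import Function.Bundles using (_⇔_; mk⇔; Equivalence)
open import Relation.Binary.Definitions using (DecidableEquality; tri<; tri≈; tri>)
open import Relation.Binary.PropositionalEquality
  using (_≡_; _≢_; refl; sym; trans; cong; cong₂; subst; subst₂; module ≡-Reasoning)
open import Relation.Nullary.Decidable using (does; yes; no)
open import Relation.Nullary.Negation using (¬_; contradiction)

-- Non-edges cannot simply be dropped, because each set must consist of exactly N distinct numbers;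
-- the flag keeps them in the sets but out of every solution. Distinctness also forces each
-- coordinate of a triple to show up in some digit. Each vertex has copies in three of the four
-- triples, and two equalities make them agree: this gives 4 · 2 = 8 digits, each summing to a
-- difference of two copies. Digits are thus signed, and the argument rests on zero having only the
-- trivial representation by digits smaller than the base in absolute value. Writing the instance
-- down would add n³ steps, too many once ε > 1/3; leaving it virtual avoids a case distinction on
-- ε. The price is that every `input` instruction must become branch-free code of constant size that
-- respects the word limit at each intermediate value and is right at every address, in range or
-- not.

-- Register updates and the size of arithmetic results.

module _ {A : Set} (_≟_ : DecidableEquality A) (f : A → ℤ) where

  update-same : ∀ a v → update _≟_ f a v a ≡ v
  update-same a v with a ≟ a
  ... | yes _   = refl
  ... | no  a≢a = contradiction refl a≢a

  update-other : ∀ {a x} v → x ≢ a → update _≟_ f a v x ≡ f x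
  update-other {a} {x} v x≢a with x ≟ a
  ... | yes x≡a = contradiction x≡a x≢a
  ... | no  _   = refl

update-cong : ∀ {A : Set} (_≟_ : DecidableEquality A) {f g : A → ℤ} a v →
              (∀ x → f x ≡ g x) → ∀ x → update _≟_ f a v x ≡ update _≟_ g a v x
update-cong _≟_ a v f≗g x with x ≟ a
... | yes _ = refl
... | no  _ = f≗g x

-- Allows a constant number of extra steps to be absorbed into a constant factor.
Run⇒1≤t : ∀ {W inp p σ t σ′} → Run W inp p σ t σ′ → 1 ≤ t
Run⇒1≤t run-skip         = s≤s z≤n
Run⇒1≤t (run-assign _)   = s≤s z≤n
Run⇒1≤t run-store        = s≤s z≤n
Run⇒1≤t (run-seq p _)    = ℕ.≤-trans (Run⇒1≤t p) (ℕ.m≤m+n _ _)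
Run⇒1≤t (run-then _ _)   = s≤s z≤n
Run⇒1≤t (run-else _ _)   = s≤s z≤n
Run⇒1≤t (run-exit _)     = s≤s z≤n
Run⇒1≤t (run-loop _ _ _) = s≤s z≤n

-- Division rounds down, so a negative dividend with nonzero remainder gives a quotient one larger
-- in absolute value than the natural one.
∣i/ℕd∣≤1+∣i∣ : ∀ i d .{{_ : ℕ.NonZero d}} → ∣ i ℤ./ℕ d ∣ ≤ suc ∣ i ∣
∣i/ℕd∣≤1+∣i∣ (+ n) d = ℕ.m≤n⇒m≤1+n (ℕ.m/n≤m n d)
∣i/ℕd∣≤1+∣i∣ -[1+ n ] d with suc n ℕ.% d
... | zero  = ℕ.≤-trans (ℕ.≤-reflexive (ℤ.∣-i∣≡∣i∣ (+ (suc n ℕ./ d))))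
                        (ℕ.m≤n⇒m≤1+n (ℕ.m/n≤m (suc n) d))
... | suc _ = s≤s (ℕ.m/n≤m (suc n) d)

∣i/j∣≤1+∣i∣ : ∀ i j .{{_ : ℤ.NonZero j}} → ∣ i ℤ./ j ∣ ≤ suc ∣ i ∣
∣i/j∣≤1+∣i∣ i j = begin
  ∣ i ℤ./ j ∣                                ≡⟨ ℤ.abs-* (ℤ.sign j ℤ.◃ 1) q ⟩
  ∣ ℤ.sign j ℤ.◃ 1 ∣ * ∣ q ∣                 ≡⟨ cong (_* ∣ q ∣) (ℤ.abs-◃ (ℤ.sign j) 1) ⟩
  1 * ∣ q ∣                                  ≡⟨ ℕ.*-identityˡ ∣ q ∣ ⟩
  ∣ q ∣                                      ≤⟨ ∣i/ℕd∣≤1+∣i∣ i ∣ j ∣ ⟩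
  suc ∣ i ∣                                  ∎
  where open ℕ.≤-Reasoning
        q = i ℤ./ℕ ∣ j ∣

-- One bound for all operations. A product bound makes exponents add when `X` and `Y` are powers of
-- `b`, and the factor 2, needed for sums, costs one more power of `b`.
∣evalOp∣≤ : ∀ o {x y X Y} → 1 ≤ X → 1 ≤ Y → ∣ x ∣ ≤ X → ∣ y ∣ ≤ Y →
            ∣ evalOp o x y ∣ ≤ 2 * (X * Y)
∣evalOp∣≤ o {x} {y} {X} {Y} 1≤X 1≤Y x≤X y≤Y = go o
  where
  open ℕ.≤-Reasoning
  X≤ : X ≤ X * Y
  X≤ = ℕ.m≤m*n X Y {{ℕ.>-nonZero 1≤Y}}
  Y≤ : Y ≤ X * Y
  Y≤ = ℕ.m≤n*m Y X {{ℕ.>-nonZero 1≤X}}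
  XY≤ : X * Y ≤ 2 * (X * Y)
  XY≤ = ℕ.m≤n*m (X * Y) 2
  sum≤ : ∀ {a b} → a ≤ X * Y → b ≤ X * Y → a + b ≤ 2 * (X * Y)
  sum≤ a≤ b≤ = ℕ.+-mono-≤ a≤ (ℕ.≤-trans b≤ (ℕ.≤-reflexive (sym (ℕ.+-identityʳ _))))
  quotient≤ : ∀ {q} → q ≤ suc ∣ x ∣ → q ≤ 2 * (X * Y)
  quotient≤ q≤ = ℕ.≤-trans q≤ (sum≤ (ℕ.≤-trans 1≤X X≤) (ℕ.≤-trans x≤X X≤))
  remainder≤ : ∀ {r} → r ℕ.< ∣ y ∣ → r ≤ 2 * (X * Y)
  remainder≤ r< = ℕ.≤-trans (ℕ.<⇒≤ r<) (ℕ.≤-trans y≤Y (ℕ.≤-trans Y≤ XY≤))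
  divides≤ : ∀ z → z ≡ y → ∣ evalOp div x z ∣ ≤ 2 * (X * Y)
  divides≤ (+ zero)   _ = z≤n
  divides≤ z@(+[1+ _ ]) _ = quotient≤ (∣i/j∣≤1+∣i∣ x z)
  divides≤ z@(-[1+ _ ]) _ = quotient≤ (∣i/j∣≤1+∣i∣ x z)
  mod≤ : ∀ z → z ≡ y → ∣ evalOp mod x z ∣ ≤ 2 * (X * Y)
  mod≤ (+ zero)   _ = z≤n
  mod≤ z@(+[1+ _ ]) refl = remainder≤ (ℤ.n%d<d x z)
  mod≤ z@(-[1+ _ ]) refl = remainder≤ (ℤ.n%d<d x z)
  go : ∀ o → ∣ evalOp o x y ∣ ≤ 2 * (X * Y)
  go add = ℕ.≤-trans (ℤ.∣i+j∣≤∣i∣+∣j∣ x y) (sum≤ (ℕ.≤-trans x≤X X≤) (ℕ.≤-trans y≤Y Y≤))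
  go sub = ℕ.≤-trans (ℤ.∣i-j∣≤∣i∣+∣j∣ x y) (sum≤ (ℕ.≤-trans x≤X X≤) (ℕ.≤-trans y≤Y Y≤))
  go mul = begin
    ∣ x ℤ.* y ∣     ≡⟨ ℤ.abs-* x y ⟩
    ∣ x ∣ * ∣ y ∣   ≤⟨ ℕ.*-mono-≤ x≤X y≤Y ⟩
    X * Y           ≤⟨ XY≤ ⟩
    2 * (X * Y)     ∎
  go div = divides≤ y refl
  go mod = mod≤ y refl
  go lt with does (x ℤ.<? y)
  ... | true  = ℕ.≤-trans (ℕ.≤-trans 1≤X X≤) XY≤
  ... | false = z≤n

-- Branch-free expressions and their compilation.

-- A word of a virtual input, computed from its address and the actual input.
data Expr : Set where
  con  : ℤ → Expr
  addr : Expr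
  bin  : Op → Expr → Expr → Expr
  read : Expr → Expr

⟦_⟧ : Expr → List ℤ → ℤ → ℤ
⟦ con c ⟧     inp a = c
⟦ addr ⟧      inp a = a
⟦ bin o e f ⟧ inp a = evalOp o (⟦ e ⟧ inp a) (⟦ f ⟧ inp a)
⟦ read e ⟧    inp a = cell inp (⟦ e ⟧ inp a)

-- Number of stack registers: the left value keeps its slot while the right operand is evaluated one
-- register higher.
width : Expr → ℕ
width (con _)     = 1
width addr        = 1
width (bin _ e f) = width e ⊔ suc (width f)
width (read e)    = width e

cost : Expr → ℕ
cost (con _)     = 1
cost addr        = 2
cost (bin _ e f) = cost e + (cost f + 1)
cost (read e)    = cost e + 1

-- For b ≥ 2, the values of e and of its subexpressions are at most
-- b ^ degree D e if the address is at most b ^ D and input words at most b.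
degree : ℕ → Expr → ℕ
degree D (con c)     = ∣ c ∣
degree D addr        = D
degree D (bin _ e f) = suc (degree D e + degree D f)
degree D (read e)    = suc (degree D e)

-- The machine has no register copy, so the source is added to a cleared target; the two registers
-- must differ.
move : Reg → Reg → Program
move k v = k ≔ const 0ℤ ⨾ k ≔ arith add v k

-- v holds the address; the result goes to k, the base of the evaluation stack.
compile : Reg → Expr → Reg → Program
compile v (con c)     k = k ≔ const c
compile v addr        k = move k v
compile v (bin o e f) k = compile v e k ⨾ compile v f (suc k) ⨾ k ≔ arith o k (suc k)
compile v (read e)    k = compile v e k ⨾ k ≔ input k

Outside : Reg → Reg → Reg → Set
Outside k l j = j ℕ.< k ⊎ l ≤ j

-- Memory can be compared by plain equality because compiled code contains no store; registers are
-- compared pointwise.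
record Frame (k l : Reg) (σ σ′ : State) : Set where
  constructor frame
  field
    regs-≡ : ∀ {j} → Outside k l j → regs σ′ j ≡ regs σ j
    mem-≡  : mem σ′ ≡ mem σ
open Frame

Frame-trans : ∀ {k l σ σ′ σ″} → Frame k l σ σ′ → Frame k l σ′ σ″ → Frame k l σ σ″
Frame-trans f g = frame (λ o → trans (regs-≡ g o) (regs-≡ f o)) (trans (mem-≡ g) (mem-≡ f))

Frame-weaken : ∀ {k k′ l l′ σ σ′} → k ≤ k′ → l′ ≤ l → Frame k′ l′ σ σ′ → Frame k l σ σ′
Frame-weaken {k} {k′} {l} {l′} k≤ ≤l f = frame (λ o → regs-≡ f (widen o)) (mem-≡ f)
  where
  widen : ∀ {j} → Outside k l j → Outside k′ l′ j
  widen (inj₁ j<k) = inj₁ (ℕ.<-≤-trans j<k k≤)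
  widen (inj₂ l≤j) = inj₂ (ℕ.≤-trans ≤l l≤j)

outside⇒≢ : ∀ {k l j} → k ℕ.< l → Outside k l j → j ≢ k
outside⇒≢ k<l (inj₁ j<k) = ℕ.<⇒≢ j<k
outside⇒≢ k<l (inj₂ l≤j) = ℕ.<⇒≢ (ℕ.<-≤-trans k<l l≤j) ∘ sym

setReg-Frame : ∀ {k l} σ v → k ℕ.< l → Frame k l σ (setReg σ k v)
setReg-Frame σ v k<l = frame (λ o → update-other ℕ._≟_ (regs σ) v (outside⇒≢ k<l o)) refl

0<width : ∀ e → 0 ℕ.< width e
0<width (con _)     = s≤s z≤n
0<width addr        = s≤s z≤n
0<width (bin _ e f) = ℕ.<-≤-trans (0<width e) (ℕ.m≤m⊔n _ _)
0<width (read e)    = 0<width e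

move-run : ∀ {W inp k v} σ → v ≢ k → ∣ regs σ v ∣ ≤ W → ∃[ σ′ ]
           Run W inp (move k v) σ 2 σ′ × regs σ′ k ≡ regs σ v × Frame k (suc k) σ σ′
move-run {W} {inp} {k} {v} σ v≢k bound =
  σ₂ , run-seq (run-assign z≤n) (run-assign bound′) ,
  trans (update-same ℕ._≟_ (regs σ₁) k _) sum≡ ,
  Frame-trans (setReg-Frame σ _ ℕ.≤-refl) (setReg-Frame σ₁ _ ℕ.≤-refl)
  where
  σ₁ = setReg σ k 0ℤ
  σ₂ = setReg σ₁ k (regs σ₁ v ℤ.+ regs σ₁ k)
  sum≡ : regs σ₁ v ℤ.+ regs σ₁ k ≡ regs σ v
  sum≡ = trans (cong₂ ℤ._+_ (update-other ℕ._≟_ (regs σ) 0ℤ v≢k)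
                            (update-same ℕ._≟_ (regs σ) k 0ℤ))
               (ℤ.+-identityʳ _)
  bound′ : ∣ regs σ₁ v ℤ.+ regs σ₁ k ∣ ≤ W
  bound′ = subst (λ i → ∣ i ∣ ≤ W) (sym sum≡) bound

module _ (b : ℕ) (2≤b : 2 ≤ b) (inp : List ℤ) (cell≤b : ∀ a → ∣ cell inp a ∣ ≤ b) where

  private instance
    b≢0 : ℕ.NonZero b
    b≢0 = ℕ.>-nonZero (ℕ.≤-trans (s≤s z≤n) 2≤b)

  -- Explains the degree of a constant: some exponent independent of `b` is needed, and the
  -- constant's own absolute value will do.
  n≤b^n : ∀ n → n ≤ b ^ n
  n≤b^n zero    = z≤n
  n≤b^n (suc n) = begin
    suc n              ≤⟨ ℕ.+-mono-≤ (ℕ.m^n>0 b n) (n≤b^n n) ⟩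
    b ^ n + b ^ n      ≡⟨ cong (λ m → b ^ n + m) (ℕ.+-identityʳ (b ^ n)) ⟨
    2 * b ^ n          ≤⟨ ℕ.*-monoˡ-≤ (b ^ n) 2≤b ⟩
    b * b ^ n          ∎
    where open ℕ.≤-Reasoning

  ⟦⟧-bound : ∀ D e {a} → ∣ a ∣ ≤ b ^ D → ∣ ⟦ e ⟧ inp a ∣ ≤ b ^ degree D e
  ⟦⟧-bound D (con c) _ = n≤b^n ∣ c ∣
  ⟦⟧-bound D addr a≤ = a≤
  ⟦⟧-bound D (read e) {a} _ = begin
    ∣ cell inp (⟦ e ⟧ inp a) ∣  ≤⟨ cell≤b (⟦ e ⟧ inp a) ⟩
    b                           ≤⟨ ℕ.m≤m*n b (b ^ degree D e) {{ℕ.m^n≢0 b (degree D e)}} ⟩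
    b * b ^ degree D e          ∎
    where open ℕ.≤-Reasoning
  ⟦⟧-bound D (bin o e f) {a} a≤ = begin
    ∣ evalOp o (⟦ e ⟧ inp a) (⟦ f ⟧ inp a) ∣
      ≤⟨ ∣evalOp∣≤ o (ℕ.m^n>0 b (degree D e)) (ℕ.m^n>0 b (degree D f))
                     (⟦⟧-bound D e a≤) (⟦⟧-bound D f a≤) ⟩
    2 * (b ^ degree D e * b ^ degree D f)    ≡⟨ cong (2 *_) (ℕ.^-distribˡ-+-* b (degree D e) _) ⟨
    2 * b ^ (degree D e + degree D f)        ≤⟨ ℕ.*-monoˡ-≤ (b ^ (degree D e + degree D f)) 2≤b ⟩
    b ^ suc (degree D e + degree D f)        ∎
    where open ℕ.≤-Reasoning

  -- The address register `v` lies above the stack, so it survives the left operand and the right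
  -- one sees the same address. The degree dominates those of all subexpressions, so intermediate
  -- values meet the word limit as well.
  compile-run : ∀ {D w} e k v σ → k + width e ≤ v → ∣ regs σ v ∣ ≤ b ^ D → degree D e ≤ w →
                ∃[ σ′ ] Run (b ^ w) inp (compile v e k) σ (cost e) σ′
                  × regs σ′ k ≡ ⟦ e ⟧ inp (regs σ v) × Frame k (k + width e) σ σ′
  compile-run {D} e₀ k v σ sep a≤ deg≤ with ⟦⟧-bound D e₀ {regs σ v} a≤
  compile-run (con c) k v σ sep a≤ deg≤ | val≤ =
    _ , run-assign (ℕ.≤-trans val≤ (ℕ.^-monoʳ-≤ b deg≤)) , update-same ℕ._≟_ (regs σ) k c ,
    setReg-Frame σ c (ℕ.m<m+n k (s≤s z≤n))
  compile-run addr k v σ sep a≤ deg≤ | val≤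
    with move-run σ (ℕ.<⇒≢ (ℕ.<-≤-trans (ℕ.m<m+n k (s≤s z≤n)) sep) ∘ sym)
           (ℕ.≤-trans val≤ (ℕ.^-monoʳ-≤ b deg≤))
  ... | σ′ , run , val , fr =
    σ′ , run , val , Frame-weaken ℕ.≤-refl (ℕ.≤-reflexive (ℕ.+-comm 1 k)) fr
  compile-run (read e) k v σ sep a≤ deg≤ | val≤
    with compile-run e k v σ sep a≤ (ℕ.≤-trans (ℕ.n≤1+n _) deg≤)
  ... | σ′ , run , val , fr =
    _ , run-seq run (run-assign (subst (λ i → ∣ i ∣ ≤ _) (sym val′)
                                  (ℕ.≤-trans val≤ (ℕ.^-monoʳ-≤ b deg≤)))) ,
    trans (update-same ℕ._≟_ (regs σ′) k _) val′ ,
    Frame-trans fr (setReg-Frame σ′ _ (ℕ.m<m+n k (0<width e)))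
    where val′ = cong (cell inp) val
  compile-run {D} (bin o e f) k v σ sep a≤ deg≤ | val≤ =
    let σ₁ , run₁ , val₁ , fr₁ = compile-run e k v σ (ℕ.≤-trans e≤ sep) a≤
          (ℕ.≤-trans (ℕ.m≤m+n _ _) (ℕ.≤-trans (ℕ.n≤1+n _) deg≤))
        v≡ = regs-≡ fr₁ (inj₂ (ℕ.≤-trans e≤ sep))
        σ₂ , run₂ , val₂ , fr₂ = compile-run f (suc k) v σ₁ (ℕ.≤-trans f≤ sep)
          (subst (λ i → ∣ i ∣ ≤ b ^ D) (sym v≡) a≤)
          (ℕ.≤-trans (ℕ.m≤n+m _ _) (ℕ.≤-trans (ℕ.n≤1+n _) deg≤))
        val = cong₂ (evalOp o) (trans (regs-≡ fr₂ (inj₁ ℕ.≤-refl)) val₁)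
                               (trans val₂ (cong (⟦ f ⟧ inp) v≡))
    in _ , run-seq run₁ (run-seq run₂ (run-assign
             (subst (λ i → ∣ i ∣ ≤ _) (sym val) (ℕ.≤-trans val≤ (ℕ.^-monoʳ-≤ b deg≤))))) ,
       trans (update-same ℕ._≟_ (regs σ₂) k _) val ,
       Frame-trans (Frame-weaken ℕ.≤-refl e≤ fr₁)
         (Frame-trans (Frame-weaken (ℕ.n≤1+n k) f≤ fr₂)
           (setReg-Frame σ₂ _ (ℕ.m<m+n k (0<width (bin o e f)))))
    where
    e≤ : k + width e ≤ k + (width e ⊔ suc (width f))
    e≤ = ℕ.+-monoʳ-≤ k (ℕ.m≤m⊔n _ _)
    f≤ : suc k + width f ≤ k + (width e ⊔ suc (width f))
    f≤ = ℕ.≤-trans (ℕ.≤-reflexive (sym (ℕ.+-suc k (width f)))) (ℕ.+-monoʳ-≤ k (ℕ.m≤n⊔m (width e) _))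

-- Simulation of a program on a virtual input.

-- Runs p on the virtual input given by e, with the registers of p shifted
-- above the evaluation stack of e.
simulate : Expr → Program → Program
simulate e skip                  = skip
simulate e (r ≔ const c)         = (width e + r) ≔ const c
simulate e (r ≔ arith o s s′)    = (width e + r) ≔ arith o (width e + s) (width e + s′)
simulate e (r ≔ load s)          = (width e + r) ≔ load (width e + s)
simulate e (r ≔ input s)         = compile (width e + s) e 0 ⨾ move (width e + r) 0
simulate e (store[ r ] s)        = store[ width e + r ] (width e + s)
simulate e (p ⨾ q)               = simulate e p ⨾ simulate e q
simulate e (if r ≢0 p else q)    = if width e + r ≢0 simulate e p else simulate e q
simulate e (while r ≢0 p)        = while width e + r ≢0 simulate e p

-- Registers below `K` are scratch space and unconstrained. `bounded` is part of the invariant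
-- because `Run` limits only newly computed values, whereas a compiled read starts from an address
-- that is already in a register.
record Simulates (K W : ℕ) (σ τ : State) : Set where
  constructor simulates
  field
    shifted : ∀ r → regs τ (K + r) ≡ regs σ r
    same    : ∀ a → mem τ a ≡ mem σ a
    bounded : ∀ r → ∣ regs σ r ∣ ≤ W
open Simulates

initial-Simulates : ∀ K W → Simulates K W initial initial
initial-Simulates K W = simulates (λ _ → refl) (λ _ → refl) (λ _ → z≤n)

module _ {K W : ℕ} {σ τ : State} (sim : Simulates K W σ τ) where

  Simulates-Frame : ∀ {k τ′} → k ≤ K → Frame 0 k τ τ′ → Simulates K W σ τ′
  Simulates-Frame {k} {τ′} k≤K (frame regs-≡ mem-≡) = simulates
    (λ r → trans (regs-≡ (inj₂ (ℕ.≤-trans k≤K (ℕ.m≤m+n K r)))) (shifted sim r))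
    (λ a → trans (cong (λ m → m a) mem-≡) (same sim a))
    (bounded sim)

  Simulates-setReg : ∀ r {i j τ′} → i ≡ j → ∣ j ∣ ≤ W →
    regs τ′ (K + r) ≡ i → Frame (K + r) (suc (K + r)) τ τ′ →
    Simulates K W (setReg σ r j) τ′
  Simulates-setReg r {i} {τ′ = τ′} refl j≤ val (frame regs-≡ mem-≡) =
    simulates shifted′ (λ a → trans (cong (λ m → m a) mem-≡) (same sim a)) bounded′
    where
    shifted′ : ∀ x → regs τ′ (K + x) ≡ update ℕ._≟_ (regs σ) r i x
    shifted′ x with x ℕ.≟ r
    ... | yes refl = trans val (sym (update-same ℕ._≟_ (regs σ) r i))
    ... | no  x≢r  = trans (trans (regs-≡ x-outside) (shifted sim x))
                           (sym (update-other ℕ._≟_ (regs σ) i x≢r))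
      where
      x-outside : Outside (K + r) (suc (K + r)) (K + x)
      x-outside with ℕ.<-cmp x r
      ... | tri< x<r _ _ = inj₁ (ℕ.+-monoʳ-< K x<r)
      ... | tri≈ _ x≡r _ = contradiction x≡r x≢r
      ... | tri> _ _ r<x = inj₂ (ℕ.+-monoʳ-< K r<x)
    bounded′ : ∀ x → ∣ update ℕ._≟_ (regs σ) r i x ∣ ≤ W
    bounded′ x with x ℕ.≟ r
    ... | yes refl = subst (λ v → ∣ v ∣ ≤ W) (sym (update-same ℕ._≟_ (regs σ) r i)) j≤
    ... | no  x≢r  = subst (λ v → ∣ v ∣ ≤ W) (sym (update-other ℕ._≟_ (regs σ) i x≢r)) (bounded sim x)

  Simulates-assign : ∀ r {i j} → i ≡ j → ∣ j ∣ ≤ W →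
    Simulates K W (setReg σ r j) (setReg τ (K + r) i)
  Simulates-assign r {i} i≡j j≤ =
    Simulates-setReg r i≡j j≤ (update-same ℕ._≟_ (regs τ) (K + r) i)
      (setReg-Frame τ i ℕ.≤-refl)

  Simulates-setMem : ∀ {a a′ i j} → a ≡ a′ → i ≡ j →
    Simulates K W (setMem σ a′ j) (setMem τ a i)
  Simulates-setMem {a} {i = i} refl refl =
    simulates (shifted sim) (update-cong ℤ._≟_ a i (same sim)) (bounded sim)

module _ (b : ℕ) (2≤b : 2 ≤ b) {inp : List ℤ} (cell≤b : ∀ a → ∣ cell inp a ∣ ≤ b)
         (e : Expr) {inp′ : List ℤ} (correct : ∀ a → ⟦ e ⟧ inp a ≡ cell inp′ a)
         (D : ℕ) {W : ℕ} (W≤ : W ≤ b ^ D) where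

  private
    instance
      b≢0 : ℕ.NonZero b
      b≢0 = ℕ.>-nonZero (ℕ.≤-trans (s≤s z≤n) 2≤b)

    K = width e
    w = D + degree D e
    -- Slowdown per step: an `input` becomes an evaluation of `e` followed by a two-step move, and
    -- every other instruction keeps its cost.
    κ = cost e + 2

    fits : ∀ {i j} → i ≡ j → ∣ j ∣ ≤ W → ∣ i ∣ ≤ b ^ w
    fits refl j≤ = ℕ.≤-trans j≤ (ℕ.≤-trans W≤ (ℕ.^-monoʳ-≤ b (ℕ.m≤m+n D (degree D e))))

    1≤κ : ∀ {t} → 1 ≤ t → 1 ≤ κ * t
    1≤κ 1≤t = ℕ.*-mono-≤ (ℕ.≤-trans (s≤s z≤n) (ℕ.m≤n+m 2 (cost e))) 1≤t

    κ-+ : ∀ {t u t′ u′} → t′ ≤ κ * t → u′ ≤ κ * u → t′ + u′ ≤ κ * (t + u)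
    κ-+ {t} {u} t≤ u≤ = ℕ.≤-trans (ℕ.+-mono-≤ t≤ u≤) (ℕ.≤-reflexive (sym (ℕ.*-distribˡ-+ κ t u)))

    κ-suc : ∀ {t t′} → t′ ≤ κ * t → suc t′ ≤ κ * suc t
    κ-suc = κ-+ {1} (1≤κ ℕ.≤-refl)

  -- By induction on the run, not on the program, so that the iterations of a loop are subruns.
  simulate-run : ∀ {p σ t σ′ τ} → Run W inp′ p σ t σ′ → Simulates K W σ τ →
    ∃[ t′ ] ∃[ τ′ ] Run (b ^ w) inp (simulate e p) τ t′ τ′ × t′ ≤ κ * t × Simulates K W σ′ τ′
  simulate-run run-skip sim = _ , _ , run-skip , 1≤κ ℕ.≤-refl , sim
  simulate-run (run-assign {r} {const c} v≤) sim =
    _ , _ , run-assign (fits {c} refl v≤) , 1≤κ ℕ.≤-refl , Simulates-assign sim r refl v≤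
  simulate-run (run-assign {r} {arith o s s′} v≤) sim =
    _ , _ , run-assign (fits v≡ v≤) , 1≤κ ℕ.≤-refl , Simulates-assign sim r v≡ v≤
    where v≡ = cong₂ (evalOp o) (shifted sim s) (shifted sim s′)
  simulate-run {σ = σ} {τ = τ} (run-assign {r} {load s} v≤) sim =
    _ , _ , run-assign (fits v≡ v≤) , 1≤κ ℕ.≤-refl , Simulates-assign sim r v≡ v≤
    where v≡ = trans (cong (mem τ) (shifted sim s)) (same sim (regs σ s))
  simulate-run {σ = σ} {τ = τ} (run-assign {r} {input s} v≤) sim =
    let a≤ = subst (λ i → ∣ i ∣ ≤ b ^ D) (sym (shifted sim s)) (ℕ.≤-trans (bounded sim s) W≤)
        τ₁ , run₁ , val₁ , fr₁ = compile-run b 2≤b inp cell≤b e 0 (K + s) τ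
          (ℕ.m≤m+n K s) a≤ (ℕ.m≤n+m _ D)
        v≡ = trans val₁ (trans (correct _) (cong (cell inp′) (shifted sim s)))
        τ₂ , run₂ , val₂ , fr₂ = move-run {k = K + r} τ₁
          (ℕ.<⇒≢ (ℕ.<-≤-trans (0<width e) (ℕ.m≤m+n K r))) (fits v≡ v≤)
    in _ , _ , run-seq run₁ run₂ , ℕ.≤-reflexive (sym (ℕ.*-identityʳ κ)) ,
       Simulates-setReg (Simulates-frame fr₁) r v≡ v≤ val₂ fr₂
    where Simulates-frame = Simulates-Frame sim ℕ.≤-refl
  simulate-run (run-store {r} {s}) sim =
    _ , _ , run-store , 1≤κ ℕ.≤-refl , Simulates-setMem sim (shifted sim r) (shifted sim s)
  simulate-run (run-seq p q) sim =
    let _ , _ , p′ , t≤ , sim₁ = simulate-run p sim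
        _ , _ , q′ , u≤ , sim₂ = simulate-run q sim₁
    in _ , _ , run-seq p′ q′ , κ-+ t≤ u≤ , sim₂
  simulate-run (run-then {r} r≢0 p) sim =
    let _ , _ , p′ , t≤ , sim′ = simulate-run p sim
    in _ , _ , run-then (r≢0 ∘ trans (sym (shifted sim r))) p′ , κ-suc t≤ , sim′
  simulate-run (run-else {r} r≡0 q) sim =
    let _ , _ , q′ , t≤ , sim′ = simulate-run q sim
    in _ , _ , run-else (trans (shifted sim r) r≡0) q′ , κ-suc t≤ , sim′
  simulate-run (run-exit {r} r≡0) sim =
    _ , _ , run-exit (trans (shifted sim r) r≡0) , 1≤κ ℕ.≤-refl , sim
  simulate-run (run-loop {r} r≢0 p q) sim =
    let _ , _ , p′ , t≤ , sim₁ = simulate-run p sim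
        _ , _ , q′ , u≤ , sim₂ = simulate-run q sim₁
    in _ , _ , run-loop (r≢0 ∘ trans (sym (shifted sim r))) p′ q′ , κ-suc (κ-+ t≤ u≤) , sim₂

  -- The answer is expected in register 0, which belongs to the stack; the simulated register 0 is
  -- `K`, hence the final move.
  accept-run : ∀ {p t σ} → Run W inp′ p initial t σ →
    ∃[ t′ ] ∃[ τ ] Run (b ^ w) inp (simulate e p ⨾ move 0 K) initial t′ τ
      × t′ ≤ (κ + 2) * t × regs τ 0 ≡ regs σ 0
  accept-run {t = t} {σ} run =
    let t′ , τ , run′ , t≤ , sim = simulate-run run (initial-Simulates K W)
        v≡ = trans (cong (regs τ) (sym (ℕ.+-identityʳ K))) (shifted sim 0)
        τ′ , run″ , val , _ = move-run {k = 0} τ (ℕ.<⇒≢ (0<width e) ∘ sym)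
                                (fits v≡ (bounded sim 0))
    in _ , τ′ , run-seq run′ run″ ,
       ℕ.≤-trans (ℕ.+-mono-≤ t≤ (ℕ.*-monoʳ-≤ 2 (Run⇒1≤t run)))
         (ℕ.≤-reflexive (sym (ℕ.*-distribʳ-+ t κ 2))) ,
       trans val v≡

-- Numerals with signed digits.

horner : ∀ {k} → ℤ → (Fin k → ℤ) → ℤ
horner {zero}  b e = 0ℤ
horner {suc k} b e = e zero ℤ.+ b ℤ.* horner b (e ∘ suc)

horner-cong : ∀ {k} b {e f : Fin k → ℤ} → (∀ m → e m ≡ f m) → horner b e ≡ horner b f
horner-cong {zero}  b e≗f = refl
horner-cong {suc k} b e≗f = cong₂ (λ x h → x ℤ.+ b ℤ.* h) (e≗f zero) (horner-cong b (e≗f ∘ suc))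

horner-+ : ∀ {k} b (e f : Fin k → ℤ) → horner b e ℤ.+ horner b f ≡ horner b (λ m → e m ℤ.+ f m)
horner-+ {zero}  b e f = refl
horner-+ {suc k} b e f =
  trans (interchange (e zero) (f zero) b (horner b (e ∘ suc)) (horner b (f ∘ suc)))
        (cong (λ h → e zero ℤ.+ f zero ℤ.+ b ℤ.* h) (horner-+ b (e ∘ suc) (f ∘ suc)))
  where
  interchange : ∀ x y b h k → (x ℤ.+ b ℤ.* h) ℤ.+ (y ℤ.+ b ℤ.* k) ≡ (x ℤ.+ y) ℤ.+ b ℤ.* (h ℤ.+ k)
  interchange = solve-∀

horner-- : ∀ {k} b (e f : Fin k → ℤ) → horner b e ℤ.- horner b f ≡ horner b (λ m → e m ℤ.- f m)
horner-- {zero}  b e f = refl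
horner-- {suc k} b e f =
  trans (interchange (e zero) (f zero) b (horner b (e ∘ suc)) (horner b (f ∘ suc)))
        (cong (λ h → e zero ℤ.- f zero ℤ.+ b ℤ.* h) (horner-- b (e ∘ suc) (f ∘ suc)))
  where
  interchange : ∀ x y b h k → (x ℤ.+ b ℤ.* h) ℤ.- (y ℤ.+ b ℤ.* k) ≡ (x ℤ.- y) ℤ.+ b ℤ.* (h ℤ.- k)
  interchange = solve-∀

horner-0 : ∀ {k} b {e : Fin k → ℤ} → (∀ m → e m ≡ 0ℤ) → horner b e ≡ 0ℤ
horner-0 {zero}  b e≡0 = refl
horner-0 {suc k} b {e} e≡0 = trans
  (cong₂ (λ x h → x ℤ.+ b ℤ.* h) (e≡0 zero) (horner-0 b (e≡0 ∘ suc)))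
  (trans (ℤ.+-identityˡ (b ℤ.* 0ℤ)) (ℤ.*-zeroʳ b))

-- Here `e` is a multiple of `b` smaller than `b` in absolute value, so it vanishes whatever its
-- sign.
low-digit-0 : ∀ {b} e r → ∣ e ∣ ℕ.< b → e ℤ.+ + b ℤ.* r ≡ 0ℤ → e ≡ 0ℤ × r ≡ 0ℤ
low-digit-0 {b} e r e<b sum≡0 = e≡0 , r≡0
  where
  ∣e∣≡ : ∣ e ∣ ≡ b * ∣ r ∣
  ∣e∣≡ = begin
    ∣ e ∣                                        ≡⟨ cong ∣_∣ (split e (+ b ℤ.* r)) ⟩
    ∣ e ℤ.+ + b ℤ.* r ℤ.- + b ℤ.* r ∣            ≡⟨ cong (λ s → ∣ s ℤ.- + b ℤ.* r ∣) sum≡0 ⟩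
    ∣ 0ℤ ℤ.- + b ℤ.* r ∣                         ≡⟨ cong ∣_∣ (ℤ.+-identityˡ (ℤ.- (+ b ℤ.* r))) ⟩
    ∣ ℤ.- (+ b ℤ.* r) ∣                          ≡⟨ ℤ.∣-i∣≡∣i∣ (+ b ℤ.* r) ⟩
    ∣ + b ℤ.* r ∣                                ≡⟨ ℤ.abs-* (+ b) r ⟩
    b * ∣ r ∣                                    ∎
    where
    open ≡-Reasoning
    split : ∀ e s → e ≡ e ℤ.+ s ℤ.- s
    split = solve-∀
  r≡0 : r ≡ 0ℤ
  r≡0 = ℤ.∣i∣≡0⇒i≡0 (ℕ.n≤0⇒n≡0 (ℕ.≤-pred (ℕ.*-cancelˡ-< b ∣ r ∣ 1
    (ℕ.≤-trans (ℕ.≤-trans (s≤s (ℕ.≤-reflexive (sym ∣e∣≡))) e<b) (ℕ.≤-reflexive (sym (ℕ.*-identityʳ b)))))))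
  e≡0 : e ≡ 0ℤ
  e≡0 = ℤ.∣i∣≡0⇒i≡0 (trans ∣e∣≡ (trans (cong (λ i → b * ∣ i ∣) r≡0) (ℕ.*-zeroʳ b)))

-- Signed digits below `b` do not represent numbers uniquely in general, but zero they do, by
-- stripping digits from the low end. For this reason both equality of entries and the sum test are
-- reduced to a vanishing numeral.
horner-0⁻¹ : ∀ {k b} (e : Fin k → ℤ) → (∀ m → ∣ e m ∣ ℕ.< b) → horner (+ b) e ≡ 0ℤ → ∀ m → e m ≡ 0ℤ
horner-0⁻¹ {suc k} {b} e e<b h≡0 zero    =
  proj₁ (low-digit-0 (e zero) (horner (+ b) (e ∘ suc)) (e<b zero) h≡0)
horner-0⁻¹ {suc k} {b} e e<b h≡0 (suc m) =
  horner-0⁻¹ (e ∘ suc) (e<b ∘ suc)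
    (proj₂ (low-digit-0 (e zero) (horner (+ b) (e ∘ suc)) (e<b zero) h≡0)) m

∣horner∣< : ∀ {k b} (e : Fin k → ℤ) → (∀ m → ∣ e m ∣ ℕ.< b) → ∣ horner (+ b) e ∣ ℕ.< b ^ k
∣horner∣< {zero}      e e<b = s≤s z≤n
∣horner∣< {suc k} {b} e e<b = begin-strict
  ∣ e zero ℤ.+ + b ℤ.* h ∣        ≤⟨ ℤ.∣i+j∣≤∣i∣+∣j∣ (e zero) (+ b ℤ.* h) ⟩
  ∣e∣ + (∣ + b ℤ.* h ∣)           ≡⟨ cong (∣e∣ ℕ.+_) (ℤ.abs-* (+ b) h) ⟩
  ∣e∣ + b * ∣h∣                   <⟨ ℕ.+-monoˡ-< (b * ∣h∣) (e<b zero) ⟩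
  b + b * ∣h∣                     ≡⟨ ℕ.*-suc b ∣h∣ ⟨
  b * suc ∣h∣                     ≤⟨ ℕ.*-monoʳ-≤ b (∣horner∣< (e ∘ suc) (e<b ∘ suc)) ⟩
  b * b ^ k                       ∎
  where open ℕ.≤-Reasoning
        h = horner (+ b) (e ∘ suc)
        ∣e∣ = ∣ e zero ∣
        ∣h∣ = ∣ h ∣

-- Arrangement of the digits.

data Digit : Set where
  none    : Digit
  pos neg : Fin 3 → Digit

digit : (Fin 3 → ℤ) → Digit → ℤ
digit x none    = 0ℤ
digit x (pos v) = x v
digit x (neg v) = 0ℤ ℤ.- x v

-- Set i holds the triples that miss group i; each of the four groups has
-- three copies, made equal by two of the eight columns.
layout : Fin 4 → Fin 8 → Digit
layout i = lookup (lookup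
  ( (none   ∷ none   ∷ pos 0F ∷ none   ∷ pos 1F ∷ none   ∷ pos 2F ∷ none   ∷ [])
  ∷ (pos 0F ∷ none   ∷ none   ∷ none   ∷ neg 1F ∷ pos 1F ∷ neg 2F ∷ pos 2F ∷ [])
  ∷ (neg 0F ∷ pos 0F ∷ neg 1F ∷ pos 1F ∷ none   ∷ none   ∷ none   ∷ neg 2F ∷ [])
  ∷ (none   ∷ neg 0F ∷ none   ∷ neg 1F ∷ none   ∷ neg 2F ∷ none   ∷ none   ∷ [])
  ∷ []) i)

-- The layout read by columns: columns 2g and 2g + 1 chain together the three copies of group g.
plus minus : Fin 8 → Fin 4 × Fin 3
plus  = lookup ( (1F , 0F) ∷ (2F , 0F) ∷ (0F , 0F) ∷ (2F , 1F)
               ∷ (0F , 1F) ∷ (1F , 1F) ∷ (0F , 2F) ∷ (1F , 2F) ∷ [])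
minus = lookup ( (2F , 0F) ∷ (3F , 0F) ∷ (2F , 1F) ∷ (3F , 1F)
               ∷ (1F , 1F) ∷ (3F , 2F) ∷ (1F , 2F) ∷ (2F , 2F) ∷ [])

Σ₄ : (Fin 4 → ℤ) → ℤ
Σ₄ f = f 0F ℤ.+ f 1F ℤ.+ f 2F ℤ.+ f 3F

Σ₄-column : ∀ (x : Fin 4 → Fin 3 → ℤ) m →
            Σ₄ (λ i → digit (x i) (layout i m)) ≡ uncurry x (plus m) ℤ.- uncurry x (minus m)
Σ₄-column x = column
  where
  -- In `sᵢⱼ` the positive copy is in set i and the negative one in set j; the pair 0, 3 does not
  -- arise.
  s₀₁ : ∀ u v → u ℤ.+ (0ℤ ℤ.- v) ℤ.+ 0ℤ ℤ.+ 0ℤ ≡ u ℤ.- v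
  s₀₁ = solve-∀
  s₀₂ : ∀ u v → u ℤ.+ 0ℤ ℤ.+ (0ℤ ℤ.- v) ℤ.+ 0ℤ ≡ u ℤ.- v
  s₀₂ = solve-∀
  s₁₂ : ∀ u v → 0ℤ ℤ.+ u ℤ.+ (0ℤ ℤ.- v) ℤ.+ 0ℤ ≡ u ℤ.- v
  s₁₂ = solve-∀
  s₁₃ : ∀ u v → 0ℤ ℤ.+ u ℤ.+ 0ℤ ℤ.+ (0ℤ ℤ.- v) ≡ u ℤ.- v
  s₁₃ = solve-∀
  s₂₃ : ∀ u v → 0ℤ ℤ.+ 0ℤ ℤ.+ u ℤ.+ (0ℤ ℤ.- v) ≡ u ℤ.- v
  s₂₃ = solve-∀
  column : ∀ m → Σ₄ (λ i → digit (x i) (layout i m)) ≡ uncurry x (plus m) ℤ.- uncurry x (minus m)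
  column 0F = s₁₂ (x 1F 0F) (x 2F 0F)
  column 1F = s₂₃ (x 2F 0F) (x 3F 0F)
  column 2F = s₀₂ (x 0F 0F) (x 2F 1F)
  column 3F = s₂₃ (x 2F 1F) (x 3F 1F)
  column 4F = s₀₁ (x 0F 1F) (x 1F 1F)
  column 5F = s₁₃ (x 1F 1F) (x 3F 2F)
  column 6F = s₀₁ (x 0F 2F) (x 1F 2F)
  column 7F = s₁₂ (x 1F 2F) (x 2F 2F)

data Occurs (v : Fin 3) : Digit → Set where
  pos : Occurs v (pos v)
  neg : Occurs v (neg v)

-- No coordinate is lost, so an entry determines its triple and the enumeration of each set is
-- injective.
occurs : ∀ i v → ∃[ m ] Occurs v (layout i m)
occurs 0F 0F = 2F , pos
occurs 0F 1F = 4F , pos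
occurs 0F 2F = 6F , pos
occurs 1F 0F = 0F , pos
occurs 1F 1F = 5F , pos
occurs 1F 2F = 7F , pos
occurs 2F 0F = 1F , pos
occurs 2F 1F = 3F , pos
occurs 2F 2F = 7F , neg
occurs 3F 0F = 1F , neg
occurs 3F 1F = 3F , neg
occurs 3F 2F = 5F , neg

∣toℕ-toℕ∣<n : ∀ {n} (i j : Fin n) → ∣ + toℕ i ℤ.- + toℕ j ∣ ℕ.< n
∣toℕ-toℕ∣<n {n} i j = subst (λ d → ∣ d ∣ ℕ.< n) (sym (ℤ.m-n≡m⊖n (toℕ i) (toℕ j)))
  (ℕ.≤-<-trans (ℤ.∣m⊝n∣≤m⊔n (toℕ i) (toℕ j)) (ℕ.⊔-lub (Fin.toℕ<n i) (Fin.toℕ<n j)))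

toℕ-toℕ≡0⇒≡ : ∀ {n} {i j : Fin n} → + toℕ i ℤ.- + toℕ j ≡ 0ℤ → i ≡ j
toℕ-toℕ≡0⇒≡ eq = Fin.toℕ-injective (ℤ.+-injective (ℤ.i-j≡0⇒i≡j _ _ eq))

word : ∀ {n} → (Fin 3 → Fin n) → Fin 3 → ℤ
word x v = + toℕ (x v)

neg-difference : ∀ u v → (0ℤ ℤ.- u) ℤ.- (0ℤ ℤ.- v) ≡ v ℤ.- u
neg-difference = solve-∀

-- Within one set a column has a fixed sign, so both digits lie in the same range of n values and
-- their difference stays below the base.
∣digit-digit∣<n : ∀ {n} (x y : Fin 3 → Fin n) d → ∣ digit (word x) d ℤ.- digit (word y) d ∣ ℕ.< n
∣digit-digit∣<n x y none    = ℕ.≤-<-trans z≤n (Fin.toℕ<n (x 0F))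
∣digit-digit∣<n x y (pos v) = ∣toℕ-toℕ∣<n (x v) (y v)
∣digit-digit∣<n {n} x y (neg v) = subst (λ d → ∣ d ∣ ℕ.< n)
  (sym (neg-difference (word x v) (word y v))) (∣toℕ-toℕ∣<n (y v) (x v))

digit-digit≡0⇒≡ : ∀ {n} {x y : Fin 3 → Fin n} {v d} → Occurs v d →
                  digit (word x) d ℤ.- digit (word y) d ≡ 0ℤ → x v ≡ y v
digit-digit≡0⇒≡ pos eq = toℕ-toℕ≡0⇒≡ eq
digit-digit≡0⇒≡ {x = x} {y} {v} neg eq =
  sym (toℕ-toℕ≡0⇒≡ (trans (sym (neg-difference (word x v) (word y v))) eq))

∣digit∣<n : ∀ {n} (x : Fin 3 → Fin n) d → ∣ digit (word x) d ∣ ℕ.< n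
∣digit∣<n x none    = ℕ.≤-<-trans z≤n (Fin.toℕ<n (x 0F))
∣digit∣<n x (pos v) = Fin.toℕ<n (x v)
∣digit∣<n {n} x (neg v) = subst (λ d → d ℕ.< n)
  (sym (trans (cong ∣_∣ (ℤ.+-identityˡ (ℤ.- word x v))) (ℤ.∣-i∣≡∣i∣ (word x v)))) (Fin.toℕ<n (x v))

-- Entries of the 4-SUM sets.

-- Edges get 0, so that a sum of flags, being nonnegative, vanishes only when all triples are edges.
flag : Bool → ℕ
flag true  = 0
flag false = 1

flag≤1 : ∀ t → flag t ≤ 1
flag≤1 true  = z≤n
flag≤1 false = s≤s z≤n

flag≡0⇒true : ∀ {t} → flag t ≡ 0 → t ≡ true
flag≡0⇒true {true} _ = refl

row : ∀ {n} → Fin 4 → (Fin 3 → Fin n) → Fin 8 → ℤ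
row i x m = digit (word x) (layout i m)

-- In base n, digits and their differences are too small to carry, and the
-- sum of four flags is too small to carry in base 5.
entry : ∀ n → Fin 4 → (Fin 3 → Fin n) → Bool → ℤ
entry n i x t = + flag t ℤ.+ + 5 ℤ.* horner (+ n) (row i x)

entry-injective : ∀ {n} i {x y : Fin 3 → Fin n} {t u} → entry n i x t ≡ entry n i y u →
                  ∀ v → x v ≡ y v
entry-injective {n} i {x} {y} {t} {u} eq v =
  let m , occ = occurs i v
  in digit-digit≡0⇒≡ occ (horner-0⁻¹ (λ m → row i x m ℤ.- row i y m)
       (λ m → ∣digit-digit∣<n x y (layout i m)) h≡0 m)
  where
  hx = horner (+ n) (row i x)
  hy = horner (+ n) (row i y)
  regroup : ∀ f g h k → (f ℤ.- g) ℤ.+ + 5 ℤ.* (h ℤ.- k) ≡ (f ℤ.+ + 5 ℤ.* h) ℤ.- (g ℤ.+ + 5 ℤ.* k)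
  regroup = solve-∀
  flag<5 : ∣ + flag t ℤ.- + flag u ∣ ℕ.< 5
  flag<5 = s≤s (ℕ.≤-trans (ℤ.∣i-j∣≤∣i∣+∣j∣ (+ flag t) (+ flag u))
    (ℕ.≤-trans (ℕ.+-mono-≤ (flag≤1 t) (flag≤1 u)) (s≤s (s≤s z≤n))))
  h≡0 : horner (+ n) (λ m → row i x m ℤ.- row i y m) ≡ 0ℤ
  h≡0 = trans (sym (horner-- (+ n) (row i x) (row i y)))
    (proj₂ (low-digit-0 (+ flag t ℤ.- + flag u) (hx ℤ.- hy) flag<5 (trans (regroup (+ flag t) (+ flag u) hx hy) (ℤ.i≡j⇒i-j≡0 eq))))

module _ {n} (x : Fin 4 → Fin 3 → Fin n) (t : Fin 4 → Bool) where

  private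
    flags : ℕ
    flags = flag (t 0F) + flag (t 1F) + flag (t 2F) + flag (t 3F)

    differences : Fin 8 → ℤ
    differences m = uncurry (word ∘ x) (plus m) ℤ.- uncurry (word ∘ x) (minus m)

  -- `horner` is additive in its digits, so the four rows can be added column by column, where
  -- `Σ₄-column` applies.
  Σ₄-entry : Σ₄ (λ i → entry n i (x i) (t i)) ≡ + flags ℤ.+ + 5 ℤ.* horner (+ n) differences
  Σ₄-entry = trans (regroup (f 0F) (f 1F) (f 2F) (f 3F) (h 0F) (h 1F) (h 2F) (h 3F))
    (cong (λ s → + flags ℤ.+ + 5 ℤ.* s) Σ₄-horner)
    where
    f = λ i → + flag (t i)
    d : Fin 4 → Fin 8 → ℤ
    d i = row i (x i)
    h = λ i → horner (+ n) (d i)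
    regroup : ∀ a b c d e f g h →
      a ℤ.+ + 5 ℤ.* e ℤ.+ (b ℤ.+ + 5 ℤ.* f) ℤ.+ (c ℤ.+ + 5 ℤ.* g) ℤ.+ (d ℤ.+ + 5 ℤ.* h)
      ≡ a ℤ.+ b ℤ.+ c ℤ.+ d ℤ.+ + 5 ℤ.* (e ℤ.+ f ℤ.+ g ℤ.+ h)
    regroup = solve-∀
    Σ₄-horner : Σ₄ h ≡ horner (+ n) differences
    Σ₄-horner = begin
      h 0F ℤ.+ h 1F ℤ.+ h 2F ℤ.+ h 3F
        ≡⟨ cong (λ s → s ℤ.+ h 2F ℤ.+ h 3F) (horner-+ (+ n) (d 0F) (d 1F)) ⟩
      horner (+ n) (λ m → d 0F m ℤ.+ d 1F m) ℤ.+ h 2F ℤ.+ h 3F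
        ≡⟨ cong (ℤ._+ h 3F) (horner-+ (+ n) (λ m → d 0F m ℤ.+ d 1F m) (d 2F)) ⟩
      horner (+ n) (λ m → d 0F m ℤ.+ d 1F m ℤ.+ d 2F m) ℤ.+ h 3F
        ≡⟨ horner-+ (+ n) (λ m → d 0F m ℤ.+ d 1F m ℤ.+ d 2F m) (d 3F) ⟩
      horner (+ n) (λ m → d 0F m ℤ.+ d 1F m ℤ.+ d 2F m ℤ.+ d 3F m)
        ≡⟨ horner-cong (+ n) (Σ₄-column (word ∘ x)) ⟩
      horner (+ n) differences ∎
      where open ≡-Reasoning

  Σ₄-entry≡0⇒ : Σ₄ (λ i → entry n i (x i) (t i)) ≡ 0ℤ →
                (∀ i → t i ≡ true) × (∀ m → uncurry x (plus m) ≡ uncurry x (minus m))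
  Σ₄-entry≡0⇒ sum≡0 = true? , λ m → toℕ-toℕ≡0⇒≡ (horner-0⁻¹ differences small (proj₂ zeros) m)
    where
    flags<5 : flags ℕ.< 5
    flags<5 = s≤s (ℕ.+-mono-≤ (ℕ.+-mono-≤ (ℕ.+-mono-≤ (flag≤1 (t 0F)) (flag≤1 (t 1F)))
                                          (flag≤1 (t 2F))) (flag≤1 (t 3F)))
    zeros = low-digit-0 (+ flags) (horner (+ n) differences) flags<5 (trans (sym Σ₄-entry) sum≡0)
    flags≡0 : flags ≡ 0
    flags≡0 = ℤ.+-injective (proj₁ zeros)
    small : ∀ m → ∣ differences m ∣ ℕ.< n
    small m = ∣toℕ-toℕ∣<n (uncurry x (plus m)) (uncurry x (minus m))
    f₀₁₂≡0 = ℕ.m+n≡0⇒m≡0 (flag (t 0F) + flag (t 1F) + flag (t 2F)) flags≡0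
    f₀₁≡0 = ℕ.m+n≡0⇒m≡0 (flag (t 0F) + flag (t 1F)) f₀₁₂≡0
    true? : ∀ i → t i ≡ true
    true? 0F = flag≡0⇒true (ℕ.m+n≡0⇒m≡0 (flag (t 0F)) f₀₁≡0)
    true? 1F = flag≡0⇒true (ℕ.m+n≡0⇒n≡0 (flag (t 0F)) f₀₁≡0)
    true? 2F = flag≡0⇒true (ℕ.m+n≡0⇒n≡0 (flag (t 0F) + flag (t 1F)) f₀₁₂≡0)
    true? 3F = flag≡0⇒true (ℕ.m+n≡0⇒n≡0 (flag (t 0F) + flag (t 1F) + flag (t 2F)) flags≡0)

  Σ₄-entry≡0⇐ : (∀ i → t i ≡ true) → (∀ m → uncurry x (plus m) ≡ uncurry x (minus m)) →
                Σ₄ (λ i → entry n i (x i) (t i)) ≡ 0ℤ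
  Σ₄-entry≡0⇐ true? consistent = trans Σ₄-entry (cong₂ (λ f h → + f ℤ.+ + 5 ℤ.* h)
    (cong₂ _+_ (cong₂ _+_ (cong₂ _+_ (f≡0 0F) (f≡0 1F)) (f≡0 2F)) (f≡0 3F))
    (horner-0 (+ n) λ m → ℤ.i≡j⇒i-j≡0 (cong (+_ ∘ toℕ) (consistent m))))
    where
    f≡0 : ∀ i → flag (t i) ≡ 0
    f≡0 i = cong flag (true? i)

-- Origin of the universe exponent 4: an entry is less than 5 n⁸ in absolute value, and 5 ≤ 2⁴ ≤ n⁴
-- for n ≥ 2, which gives n¹² = N⁴. For n = 1 all digits vanish and only the flag is left.
∣entry∣≤ : ∀ {n} i (x : Fin 3 → Fin n) t → ∣ entry n i x t ∣ ≤ (n * (n * n)) ^ 4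
∣entry∣≤ {n} i x t = ℕ.≤-trans step (cube n h<)
  where
  open ℕ.≤-Reasoning
  h = horner (+ n) (row i x)
  h< : ∣ h ∣ ℕ.< n ^ 8
  h< = ∣horner∣< (row i x) (λ m → ∣digit∣<n x (layout i m))
  step : ∣ entry n i x t ∣ ≤ 1 + 5 * ∣ h ∣
  step = begin
    ∣ + flag t ℤ.+ + 5 ℤ.* h ∣      ≤⟨ ℤ.∣i+j∣≤∣i∣+∣j∣ (+ flag t) (+ 5 ℤ.* h) ⟩
    flag t + ∣ + 5 ℤ.* h ∣          ≤⟨ ℕ.+-mono-≤ (flag≤1 t) (ℕ.≤-reflexive (ℤ.abs-* (+ 5) h)) ⟩
    1 + 5 * ∣ h ∣                   ∎
  cube : ∀ {h} n → h ℕ.< n ^ 8 → 1 + 5 * h ≤ (n * (n * n)) ^ 4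
  cube 0 ()
  cube 1 (s≤s z≤n) = s≤s z≤n
  cube {h} n@(suc (suc k)) h< = begin
    1 + 5 * h                        ≤⟨ ℕ.+-monoˡ-≤ (5 * h) (s≤s {n = 4} z≤n) ⟩
    5 + 5 * h                        ≡⟨ ℕ.*-suc 5 h ⟨
    5 * suc h                        ≤⟨ ℕ.*-mono-≤ {5} {16} (ℕ.m≤m+n 5 11) h< ⟩
    16 * n ^ 8                       ≤⟨ ℕ.*-monoˡ-≤ (n ^ 8) (ℕ.^-monoˡ-≤ 4 {2} {n} (s≤s (s≤s z≤n))) ⟩
    n ^ 4 * n ^ 8                    ≡⟨ ℕ.^-distribˡ-+-* n 4 8 ⟨
    n ^ 12                           ≡⟨ ℕ.^-*-assoc n 3 4 ⟨
    (n ^ 3) ^ 4                      ≡⟨ cong (λ m → (n * (n * m)) ^ 4) (ℕ.*-identityʳ n) ⟩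
    (n * (n * n)) ^ 4                ∎

-- Lookup in concatenated blocks.

cell-++ˡ : ∀ xs {ys i} → i ℕ.< length xs → cell (xs ++ ys) (+ i) ≡ cell xs (+ i)
cell-++ˡ (x ∷ xs) {i = zero}  _         = refl
cell-++ˡ (x ∷ xs) {i = suc i} (s≤s i<n) = cell-++ˡ xs i<n

cell-++ʳ : ∀ xs {ys} i → cell (xs ++ ys) (+ (length xs + i)) ≡ cell ys (+ i)
cell-++ʳ []       i = refl
cell-++ʳ (x ∷ xs) i = cell-++ʳ xs i

cell-tabulate : ∀ {n} (f : Fin n → ℤ) i → cell (tabulate f) (+ toℕ i) ≡ f i
cell-tabulate f zero    = refl
cell-tabulate f (suc i) = cell-tabulate (f ∘ suc) i

cell-concat : ∀ {n l} (f : Fin n → List ℤ) → (∀ i → length (f i) ≡ l) →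
              ∀ i {j} → j ℕ.< l → cell (concat (tabulate f)) (+ (l * toℕ i + j)) ≡ cell (f i) (+ j)
cell-concat {l = l} f len zero {j} j<l = begin
  cell (f zero ++ rest) (+ (l * 0 + j))   ≡⟨ cong (λ k → cell (f zero ++ rest) (+ (k + j))) (ℕ.*-zeroʳ l) ⟩
  cell (f zero ++ rest) (+ j)             ≡⟨ cell-++ˡ (f zero) (subst (j ℕ.<_) (sym (len zero)) j<l) ⟩
  cell (f zero) (+ j)                     ∎
  where open ≡-Reasoning
        rest = concat (tabulate (f ∘ suc))
cell-concat {l = l} f len (suc i) {j} j<l = begin
  cell (f zero ++ rest) (+ (l * suc (toℕ i) + j))
    ≡⟨ cong (λ k → cell (f zero ++ rest) (+ k)) index ⟩
  cell (f zero ++ rest) (+ (length (f zero) + (l * toℕ i + j)))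
    ≡⟨ cell-++ʳ (f zero) (l * toℕ i + j) ⟩
  cell rest (+ (l * toℕ i + j))
    ≡⟨ cell-concat (f ∘ suc) (len ∘ suc) i j<l ⟩
  cell (f (suc i)) (+ j) ∎
  where
  open ≡-Reasoning
  rest = concat (tabulate (f ∘ suc))
  index : l * suc (toℕ i) + j ≡ length (f zero) + (l * toℕ i + j)
  index = trans (cong (_+ j) (ℕ.*-suc l (toℕ i)))
            (trans (ℕ.+-assoc l (l * toℕ i) j) (cong (_+ (l * toℕ i + j)) (sym (len zero))))

length-concat-tabulate : ∀ {n l} (f : Fin n → List ℤ) → (∀ i → length (f i) ≡ l) →
                         length (concat (tabulate f)) ≡ n * l
length-concat-tabulate {zero}  f len = refl
length-concat-tabulate {suc n} f len = trans (List.length-++ (f zero))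
  (cong₂ _+_ (len zero) (length-concat-tabulate (f ∘ suc) (len ∘ suc)))

cell-bounded : ∀ {b xs} → All (λ x → ∣ x ∣ ≤ b) xs → ∀ a → ∣ cell xs a ∣ ≤ b
cell-bounded []       -[1+ _ ] = z≤n
cell-bounded []       (+ zero)     = z≤n
cell-bounded []       (+ suc _)    = z≤n
cell-bounded (x ∷ xs) -[1+ _ ] = z≤n
cell-bounded (x ∷ xs) (+ zero)     = x
cell-bounded (x ∷ xs) (+ suc i)    = cell-bounded xs (+ i)

-- Arithmetic decoding and selection.

div-mul-add : ∀ m q {r} → r ℕ.< m → evalOp div (+ (m * q + r)) (+ m) ≡ + q
div-mul-add m@(suc _) q {r} r<m = trans (ℤ.*-identityˡ (+ ((m * q + r) ℕ./ m))) (cong +_ (begin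
  (m * q + r) ℕ./ m            ≡⟨ ℕ.+-distrib-/-∣ˡ r (ℕ.m∣m*n q) ⟩
  m * q ℕ./ m + r ℕ./ m        ≡⟨ cong₂ _+_ (cong (ℕ._/ m) (ℕ.*-comm m q)) (ℕ.m<n⇒m/n≡0 r<m) ⟩
  q * m ℕ./ m + 0              ≡⟨ ℕ.+-identityʳ _ ⟩
  q * m ℕ./ m                  ≡⟨ ℕ.m*n/n≡m q m ⟩
  q                            ∎))
  where open ≡-Reasoning

mod-mul-add : ∀ m q {r} → r ℕ.< m → evalOp mod (+ (m * q + r)) (+ m) ≡ + r
mod-mul-add m@(suc _) q {r} r<m = cong +_ (begin
  (m * q + r) ℕ.% m    ≡⟨ cong (ℕ._% m) (trans (ℕ.+-comm (m * q) r) (cong (λ k → r + k) (ℕ.*-comm m q))) ⟩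
  (r + q * m) ℕ.% m    ≡⟨ ℕ.[m+kn]%n≡m%n r q m ⟩
  r ℕ.% m              ≡⟨ ℕ.m<n⇒m%n≡m r<m ⟩
  r                    ∎)
  where open ≡-Reasoning

-- Selection by a 0/1 factor. Both branches are always evaluated, which is harmless: division by
-- zero and reads outside the input yield 0.
ifLt : Expr → Expr → Expr → Expr → Expr
ifLt e f g h = bin add (bin mul c g) (bin mul (bin sub (con 1ℤ) c) h)
  where c = bin lt e f

module _ (inp : List ℤ) (a : ℤ) (e f g h : Expr) where

  ifLt-true : ⟦ e ⟧ inp a ℤ.< ⟦ f ⟧ inp a → ⟦ ifLt e f g h ⟧ inp a ≡ ⟦ g ⟧ inp a
  ifLt-true e<f with ⟦ e ⟧ inp a ℤ.<? ⟦ f ⟧ inp a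
  ... | no  e≮f = contradiction e<f e≮f
  ... | yes _   = trans (ℤ.+-identityʳ _) (ℤ.*-identityˡ _)

  ifLt-false : ¬ ⟦ e ⟧ inp a ℤ.< ⟦ f ⟧ inp a → ⟦ ifLt e f g h ⟧ inp a ≡ ⟦ h ⟧ inp a
  ifLt-false e≮f with ⟦ e ⟧ inp a ℤ.<? ⟦ f ⟧ inp a
  ... | yes e<f = contradiction e<f e≮f
  ... | no  _   = trans (ℤ.+-identityˡ _) (ℤ.*-identityˡ _)

-- Triples as row-major positions in the adjacency tensor.

-- The tensor and all four sets use this one order, so the position of an entry in its set is also
-- the position of its edge bit.
index : ∀ {n} → (Fin 3 → Fin n) → Fin (n * (n * n))
index x = combine (x 0F) (combine (x 1F) (x 2F))

module _ (n : ℕ) where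

  coords : Fin (n * (n * n)) → Fin 3 → Fin n
  coords j 0F = proj₁ (remQuot {n} (n * n) j)
  coords j 1F = proj₁ (remQuot {n} n (proj₂ (remQuot {n} (n * n) j)))
  coords j 2F = proj₂ (remQuot {n} n (proj₂ (remQuot {n} (n * n) j)))

  index-coords : ∀ j → index (coords j) ≡ j
  index-coords j = trans
    (cong (combine (coords j 0F)) (Fin.combine-remQuot {n} n (proj₂ (remQuot {n} (n * n) j))))
    (Fin.combine-remQuot {n} (n * n) j)

  coords-injective : ∀ i j → (∀ v → coords i v ≡ coords j v) → i ≡ j
  coords-injective i j eq = begin
    i                  ≡⟨ index-coords i ⟨
    index (coords i)   ≡⟨ cong₂ combine (eq 0F) (cong₂ combine (eq 1F) (eq 2F)) ⟩
    index (coords j)   ≡⟨ index-coords j ⟩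
    j                  ∎
    where open ≡-Reasoning

  coords-index : ∀ x v → coords (index x) v ≡ x v
  coords-index x = unindex
    where
    outer : remQuot {n} (n * n) (index x) ≡ (x 0F , combine (x 1F) (x 2F))
    outer = Fin.remQuot-combine (x 0F) (combine (x 1F) (x 2F))
    inner : remQuot {n} n (proj₂ (remQuot {n} (n * n) (index x))) ≡ (x 1F , x 2F)
    inner = trans (cong (remQuot {n} n ∘ proj₂) outer) (Fin.remQuot-combine (x 1F) (x 2F))
    unindex : ∀ v → coords (index x) v ≡ x v
    unindex 0F = cong proj₁ outer
    unindex 1F = cong proj₁ inner
    unindex 2F = cong proj₂ inner

toℕ-index : ∀ {n} (x : Fin 3 → Fin n) →
            toℕ (index x) ≡ n * n * toℕ (x 0F) + (n * toℕ (x 1F) + toℕ (x 2F))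
toℕ-index {n} x = trans (Fin.toℕ-combine (x 0F) (combine (x 1F) (x 2F)))
  (cong (λ k → n * n * toℕ (x 0F) + k) (Fin.toℕ-combine (x 1F) (x 2F)))

low<n*n : ∀ {n} (y z : Fin n) → n * toℕ y + toℕ z ℕ.< n * n
low<n*n {n} y z = subst (ℕ._< n * n) (Fin.toℕ-combine y z) (Fin.toℕ<n (combine y z))

-- Triples may repeat a vertex; they then span fewer than three vertices, so by `uniform` they are
-- not edges.
isEdge : ∀ {n} → Hypergraph₃ n → (Fin 3 → Fin n) → Bool
isEdge H x = edge H (⁅ x 0F ⁆ ∪ ⁅ x 1F ⁆ ∪ ⁅ x 2F ⁆)

module _ {n} (H : Hypergraph₃ n) where

  private
    bit : Fin n → Fin n → Fin n → ℤ
    bit x y z = if edge H (⁅ x ⁆ ∪ ⁅ y ⁆ ∪ ⁅ z ⁆) then 1ℤ else 0ℤ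

    line : Fin n → Fin n → List ℤ
    line x y = tabulate (bit x y)

    plane : Fin n → List ℤ
    plane x = concat (tabulate (line x))

    ∣bit∣≤1 : ∀ x y z → ∣ bit x y z ∣ ≤ 1
    ∣bit∣≤1 x y z with edge H (⁅ x ⁆ ∪ ⁅ y ⁆ ∪ ⁅ z ⁆)
    ... | true  = s≤s z≤n
    ... | false = z≤n

  cell-encodeHypergraph : ∀ x → cell (encodeHypergraph H) (+ suc (toℕ (index x)))
                                ≡ (if isEdge H x then 1ℤ else 0ℤ)
  cell-encodeHypergraph x = begin
    cell (concat (tabulate plane)) (+ toℕ (index x))
      ≡⟨ cong (λ k → cell (concat (tabulate plane)) (+ k)) (toℕ-index x) ⟩
    cell (concat (tabulate plane)) (+ (n * n * toℕ (x 0F) + (n * toℕ (x 1F) + toℕ (x 2F))))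
      ≡⟨ cell-concat plane (λ a → length-concat-tabulate (line a) (λ b → List.length-tabulate (bit a b)))
           (x 0F) (low<n*n (x 1F) (x 2F)) ⟩
    cell (plane (x 0F)) (+ (n * toℕ (x 1F) + toℕ (x 2F)))
      ≡⟨ cell-concat (line (x 0F)) (λ b → List.length-tabulate (bit (x 0F) b)) (x 1F) (Fin.toℕ<n (x 2F)) ⟩
    cell (line (x 0F) (x 1F)) (+ toℕ (x 2F))
      ≡⟨ cell-tabulate (bit (x 0F) (x 1F)) (x 2F) ⟩
    bit (x 0F) (x 1F) (x 2F) ∎
    where open ≡-Reasoning

  encodeHypergraph-bounded : ∀ a → ∣ cell (encodeHypergraph H) a ∣ ≤ n + 2
  encodeHypergraph-bounded = cell-bounded (ℕ.m≤m+n n 2 ∷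
    All.concat⁺ (All.tabulate⁺ λ x → All.concat⁺ (All.tabulate⁺ λ y → All.tabulate⁺ λ z →
      ℕ.≤-trans (∣bit∣≤1 x y z) (ℕ.≤-trans (s≤s z≤n) (ℕ.m≤n+m 2 n)))))

-- The virtual 4-SUM instance and the expression for its words.

fourSum : ∀ {n} → Hypergraph₃ n → FourSumInstance 4 (n * (n * n))
fourSum {n} H = record
  { A         = λ i j → entry n i (coords n j) (isEdge H (coords n j))
  ; injective = λ i {j} {k} eq → coords-injective n j k
      (entry-injective i {coords n j} {coords n k} {isEdge H (coords n j)} {isEdge H (coords n k)} eq)
  ; bounded   = λ i j → ∣entry∣≤ i (coords n j) (isEdge H (coords n j))
  }

n¹ n² n³ : Expr
n¹ = read (con 0ℤ)
n² = bin mul n¹ n¹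
n³ = bin mul n¹ n²

coordE : Expr → Fin 3 → Expr
coordE j 0F = bin div j n²
coordE j 1F = bin div (bin mod j n²) n¹
coordE j 2F = bin mod (bin mod j n²) n¹

digitE : (Fin 3 → Expr) → Digit → Expr
digitE x none    = con 0ℤ
digitE x (pos v) = x v
digitE x (neg v) = bin sub (con 0ℤ) (x v)

hornerE : ∀ {k} → (Fin k → Expr) → Expr
hornerE {zero}  e = con 0ℤ
hornerE {suc k} e = bin add (e zero) (bin mul n¹ (hornerE (e ∘ suc)))

-- Subtracting the edge bit from 1 gives the flag; the offset 1 in the address skips the vertex
-- count.
entryE : Fin 4 → Expr → Expr
entryE i j = bin add (bin sub (con 1ℤ) (read (bin add (con 1ℤ) j)))
                     (bin mul (con (+ 5)) (hornerE (λ m → digitE (coordE j) (layout i m))))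

-- The recursion over sets unrolls into an expression of fixed size. Past the last block it gives 0,
-- as `cell` does.
blocksE : ∀ {k} → (Fin k → Expr → Expr) → Expr → Expr
blocksE {zero}  f j = con 0ℤ
blocksE {suc k} f j = ifLt j n³ (f zero j) (blocksE (f ∘ suc) (bin sub j n³))

-- Negative addresses need a case of their own, since the simulated program may read anywhere.
cellE : Expr
cellE = ifLt addr (con 0ℤ) (con 0ℤ)
         (ifLt addr (con 1ℤ) n³ (blocksE entryE (bin sub addr (con 1ℤ))))

module _ {n} (H : Hypergraph₃ n) (a : ℤ) where

  private
    N = n * (n * n)
    inp = encodeHypergraph H

    value : Expr → ℤ
    value e = ⟦ e ⟧ inp a

  value-n² : value n² ≡ + (n * n)
  value-n² = sym (ℤ.pos-* n n)

  value-n³ : value n³ ≡ + N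
  value-n³ = trans (cong (+ n ℤ.*_) value-n²) (sym (ℤ.pos-* n (n * n)))

  value-coordE : ∀ e x → value e ≡ + toℕ (index x) → ∀ v → value (coordE e v) ≡ word x v
  value-coordE e x e≡ = go
    where
    low = n * toℕ (x 1F) + toℕ (x 2F)
    low< = low<n*n (x 1F) (x 2F)
    e≡′ = trans e≡ (cong +_ (toℕ-index x))
    low≡ : value (bin mod e n²) ≡ + low
    low≡ = trans (cong₂ (evalOp mod) e≡′ value-n²) (mod-mul-add (n * n) (toℕ (x 0F)) low<)
    go : ∀ v → value (coordE e v) ≡ word x v
    go 0F = trans (cong₂ (evalOp div) e≡′ value-n²) (div-mul-add (n * n) (toℕ (x 0F)) low<)
    go 1F = trans (cong (λ i → evalOp div i (+ n)) low≡) (div-mul-add n (toℕ (x 1F)) (Fin.toℕ<n (x 2F)))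
    go 2F = trans (cong (λ i → evalOp mod i (+ n)) low≡) (mod-mul-add n (toℕ (x 1F)) (Fin.toℕ<n (x 2F)))

  value-digitE : ∀ e x → (∀ v → value (e v) ≡ x v) → ∀ d → value (digitE e d) ≡ digit x d
  value-digitE e x e≡ none    = refl
  value-digitE e x e≡ (pos v) = e≡ v
  value-digitE e x e≡ (neg v) = cong (λ i → 0ℤ ℤ.- i) (e≡ v)

  value-hornerE : ∀ {k} (e : Fin k → Expr) → value (hornerE e) ≡ horner (+ n) (value ∘ e)
  value-hornerE {zero}  e = refl
  value-hornerE {suc k} e = cong (λ h → value (e zero) ℤ.+ + n ℤ.* h) (value-hornerE (e ∘ suc))

  value-entryE : ∀ i e j → value e ≡ + toℕ j → value (entryE i e) ≡ FourSumInstance.A (fourSum H) i j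
  value-entryE i e j e≡ = cong₂ (λ f h → f ℤ.+ + 5 ℤ.* h) flag≡
    (trans (value-hornerE (λ m → digitE (coordE e) (layout i m)))
      (horner-cong (+ n) λ m → value-digitE (coordE e) (word (coords n j))
        (value-coordE e (coords n j) e≡index) (layout i m)))
    where
    e≡index : value e ≡ + toℕ (index (coords n j))
    e≡index = trans e≡ (cong (+_ ∘ toℕ) (sym (index-coords n j)))
    1-bit : ∀ t → 1ℤ ℤ.- (if t then 1ℤ else 0ℤ) ≡ + flag t
    1-bit true  = refl
    1-bit false = refl
    flag≡ : value (bin sub (con 1ℤ) (read (bin add (con 1ℤ) e))) ≡ + flag (isEdge H (coords n j))
    flag≡ = trans (cong (λ i → 1ℤ ℤ.- i) (trans (cong (λ i → cell (encodeHypergraph H) (1ℤ ℤ.+ i)) e≡index)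
                                          (cell-encodeHypergraph H (coords n j))))
                  (1-bit (isEdge H (coords n j)))

  -- The hypothesis covers all expressions `e` because the index expression gains a subtraction with
  -- every block passed.
  value-blocksE : ∀ {k} (f : Fin k → Expr → Expr) (g : Fin k → Fin N → ℤ) →
    (∀ i e j → value e ≡ + toℕ j → value (f i e) ≡ g i j) →
    ∀ e j → value e ≡ + j → value (blocksE f e) ≡ cell (concat (tabulate (λ i → tabulate (g i)))) (+ j)
  value-blocksE {zero}  f g f≡g e zero    e≡ = refl
  value-blocksE {zero}  f g f≡g e (suc j) e≡ = refl
  value-blocksE {suc k} f g f≡g e j e≡ with j ℕ.<? N
  ... | yes j<N = begin
    value (blocksE f e)      ≡⟨ ifLt-true inp a e n³ (f zero e) else-branch
                                  (subst₂ ℤ._<_ (sym e≡) (sym value-n³) (ℤ.+<+ j<N)) ⟩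
    value (f zero e)         ≡⟨ f≡g zero e (fromℕ< j<N) (trans e≡ (cong +_ (sym j≡))) ⟩
    g zero (fromℕ< j<N)      ≡⟨ cell-tabulate (g zero) (fromℕ< j<N) ⟨
    cell block (+ toℕ (fromℕ< j<N))
                             ≡⟨ cong (λ i → cell block (+ i)) j≡ ⟩
    cell block (+ j)         ≡⟨ cell-++ˡ block (subst (j ℕ.<_) (sym (List.length-tabulate (g zero))) j<N) ⟨
    cell (block ++ rest) (+ j) ∎
    where
    open ≡-Reasoning
    block = tabulate (g zero)
    else-branch = blocksE (f ∘ suc) (bin sub e n³)
    rest = concat (tabulate (λ i → tabulate (g (suc i))))
    j≡ = Fin.toℕ-fromℕ< j<N
  ... | no  j≮N = begin
    value (blocksE f e)
      ≡⟨ ifLt-false inp a e n³ (f zero e) else-branch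
           (λ lt → j≮N (ℤ.drop‿+<+ (subst₂ ℤ._<_ e≡ value-n³ lt))) ⟩
    value (blocksE (f ∘ suc) (bin sub e n³))
      ≡⟨ value-blocksE (f ∘ suc) (g ∘ suc) (f≡g ∘ suc) (bin sub e n³) (j ℕ.∸ N)
           (trans (cong₂ ℤ._-_ e≡ value-n³) (trans (ℤ.m-n≡m⊖n j N) (ℤ.⊖-≥ N≤j))) ⟩
    cell rest (+ (j ℕ.∸ N))
      ≡⟨ cell-++ʳ block (j ℕ.∸ N) ⟨
    cell (block ++ rest) (+ (length block + (j ℕ.∸ N)))
      ≡⟨ cong (λ i → cell (block ++ rest) (+ i))
           (trans (cong (_+ (j ℕ.∸ N)) (List.length-tabulate (g zero))) (ℕ.m+[n∸m]≡n N≤j)) ⟩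
    cell (block ++ rest) (+ j) ∎
    where
    open ≡-Reasoning
    block = tabulate (g zero)
    else-branch = blocksE (f ∘ suc) (bin sub e n³)
    rest = concat (tabulate (λ i → tabulate (g (suc i))))
    N≤j = ℕ.≮⇒≥ j≮N

value-cellE : ∀ {n} (H : Hypergraph₃ n) a →
              ⟦ cellE ⟧ (encodeHypergraph H) a ≡ cell (Problem.encode (FourSum 4) (fourSum H)) a
value-cellE {n} H = go
  where
  inp = encodeHypergraph H
  blocks = blocksE entryE (bin sub addr (con 1ℤ))
  rest = ifLt addr (con 1ℤ) n³ blocks
  go : ∀ a → ⟦ cellE ⟧ inp a ≡ cell (Problem.encode (FourSum 4) (fourSum H)) a
  go -[1+ m ]  = ifLt-true inp -[1+ m ] addr (con 0ℤ) (con 0ℤ) rest ℤ.-<+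
  go (+ zero)  = trans (ifLt-false inp (+ zero) addr (con 0ℤ) (con 0ℤ) rest λ { (ℤ.+<+ ()) })
    (trans (ifLt-true inp (+ zero) addr (con 1ℤ) n³ blocks (ℤ.+<+ (s≤s z≤n))) (value-n³ H (+ zero)))
  go (+ suc j) = trans (ifLt-false inp (+ suc j) addr (con 0ℤ) (con 0ℤ) rest λ { (ℤ.+<+ ()) })
    (trans (ifLt-false inp (+ suc j) addr (con 1ℤ) n³ blocks λ { (ℤ.+<+ (s≤s ())) })
      (value-blocksE H (+ suc j) entryE (FourSumInstance.A (fourSum H)) (value-entryE H (+ suc j))
        (bin sub addr (con 1ℤ)) j refl))

-- Vertex sets as spans of tuples, and their faces.

card-insert≤ : ∀ {n} (x : Fin n) p → card (⁅ x ⁆ ∪ p) ≤ suc (card p)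
card-insert≤ zero    (b ∷ p) = s≤s (ℕ.≤-trans
  (ℕ.≤-reflexive (cong card (Subset.∪-identityˡ p))) (Subset.∣p∣≤∣x∷p∣ b p))
card-insert≤ (suc x) (inside  ∷ p) = s≤s (card-insert≤ x p)
card-insert≤ (suc x) (outside ∷ p) = card-insert≤ x p

card≡0⇒≡⊥ : ∀ {n} (p : Subset n) → card p ≡ 0 → p ≡ ⊥
card≡0⇒≡⊥ []            _   = refl
card≡0⇒≡⊥ (outside ∷ p) c≡0 = cong (outside ∷_) (card≡0⇒≡⊥ p c≡0)

card≡suc⇒insert : ∀ {n k} (p : Subset n) → card p ≡ suc k →
                  ∃[ x ] ∃[ q ] p ≡ ⁅ x ⁆ ∪ q × card q ≡ k
card≡suc⇒insert (inside  ∷ p) c≡ =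
  zero , outside ∷ p , cong (inside ∷_) (sym (Subset.∪-identityˡ p)) , ℕ.suc-injective c≡
card≡suc⇒insert (outside ∷ p) c≡ =
  let x , q , p≡ , q≡ = card≡suc⇒insert p c≡
  in suc x , outside ∷ q , cong (outside ∷_) p≡ , q≡

⊆∧card≤⇒≡ : ∀ {n} {p q : Subset n} → p ⊆ q → card q ≤ card p → p ≡ q
⊆∧card≤⇒≡ {p = p} {q} p⊆q q≤p = Subset.⊆-antisym p⊆q q⊆p
  where
  q⊆p : q ⊆ p
  q⊆p {x} x∈q with x Subset.∈? p
  ... | yes x∈p = x∈p
  ... | no  x∉p = contradiction q≤p (ℕ.<⇒≱ (Subset.p⊂q⇒∣p∣<∣q∣ (p⊆q , x , x∈q , x∉p)))

span : ∀ {n k} → (Fin k → Fin n) → Subset n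
span {k = zero}  w = ⊥
span {k = suc k} w = ⁅ w zero ⁆ ∪ span (w ∘ suc)

∈-span⁺ : ∀ {n k} (w : Fin k → Fin n) i → w i ∈ span w
∈-span⁺ w zero    = Subset.p⊆p∪q _ (Subset.x∈⁅x⁆ (w zero))
∈-span⁺ w (suc i) = Subset.q⊆p∪q ⁅ w zero ⁆ _ (∈-span⁺ (w ∘ suc) i)

∈-span⁻ : ∀ {n k} (w : Fin k → Fin n) {x} → x ∈ span w → ∃[ i ] x ≡ w i
∈-span⁻ {k = zero}  w x∈ = contradiction x∈ Subset.∉⊥
∈-span⁻ {k = suc k} w x∈ with Subset.x∈p∪q⁻ ⁅ w zero ⁆ _ x∈
... | inj₁ x∈w₀ = zero , Subset.x∈⁅y⁆⇒x≡y _ x∈w₀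
... | inj₂ x∈w₊ = let i , x≡ = ∈-span⁻ (w ∘ suc) x∈w₊ in suc i , x≡

span-⊆ : ∀ {n k} (w : Fin k → Fin n) {p} → (∀ i → w i ∈ p) → span w ⊆ p
span-⊆ w w∈p x∈ with ∈-span⁻ w x∈
... | i , refl = w∈p i

card-span≤ : ∀ {n k} (w : Fin k → Fin n) → card (span w) ≤ k
card-span≤ {n} {zero}  w = ℕ.≤-reflexive (Subset.∣⊥∣≡0 n)
card-span≤ {n} {suc k} w = ℕ.≤-trans (card-insert≤ (w zero) _) (s≤s (card-span≤ (w ∘ suc)))

-- Distinctness of the tuple is not recorded; the cardinality of the span stands in for it.
card≡⇒span : ∀ {n k} (p : Subset n) → card p ≡ k → Σ[ w ∈ (Fin k → Fin n) ] p ≡ span w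
card≡⇒span {k = zero}  p c≡ = (λ ()) , card≡0⇒≡⊥ p c≡
card≡⇒span {n} {suc k} p c≡ =
  let x , q , p≡ , q≡ = card≡suc⇒insert p c≡
      w , q≡span = card≡⇒span q q≡
  in cons x w , trans p≡ (cong (⁅ x ⁆ ∪_) q≡span)
  where
  cons : Fin n → (Fin k → Fin n) → Fin (suc k) → Fin n
  cons x w zero    = x
  cons x w (suc i) = w i

module _ {n k} (w : Fin (suc k) → Fin n) where

  face : Fin (suc k) → Fin k → Fin n
  face i = w ∘ punchIn i

  ∈-face : ∀ {i j} → i ≢ j → w j ∈ span (face i)
  ∈-face {i} i≢j = subst (λ l → w l ∈ span (face i)) (Fin.punchIn-punchOut i≢j)
                         (∈-span⁺ (face i) (punchOut i≢j))

  face-⊆ : ∀ i → span (face i) ⊆ span w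
  face-⊆ i = span-⊆ (face i) (λ j → ∈-span⁺ w (punchIn i j))

  -- Putting the omitted vertex back covers the whole span and adds at most one element.
  card-face : card (span w) ≡ suc k → ∀ i → card (span (face i)) ≡ k
  card-face c≡ i = ℕ.≤-antisym (card-span≤ (face i)) (ℕ.≤-pred (begin
    suc k                             ≡⟨ c≡ ⟨
    card (span w)                     ≤⟨ Subset.p⊆q⇒∣p∣≤∣q∣ (span-⊆ w covered) ⟩
    card (⁅ w i ⁆ ∪ span (face i))    ≤⟨ card-insert≤ (w i) (span (face i)) ⟩
    suc (card (span (face i)))        ∎))
    where
    open ℕ.≤-Reasoning
    covered : ∀ j → w j ∈ ⁅ w i ⁆ ∪ span (face i)
    covered j with i Fin.≟ j
    ... | yes refl = Subset.p⊆p∪q _ (Subset.x∈⁅x⁆ (w i))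
    ... | no  i≢j  = Subset.q⊆p∪q ⁅ w i ⁆ _ (∈-face i≢j)

  -- Too small to contain every `w i`, the set `e` misses one of them, hence lies in that face and
  -- fills it by cardinality.
  subset-is-face : ∀ {e} → e ⊆ span w → card e ≡ k → (∀ i → card (span (face i)) ≡ k) →
                   card (span w) ≡ suc k → ∃[ i ] e ≡ span (face i)
  subset-is-face {e} e⊆ e≡k faces≡k w≡ =
    let i , wᵢ∉e = Fin.¬∀⟶∃¬ (suc k) (λ i → w i ∈ e) (λ i → w i Subset.∈? e) not-all
    in i , ⊆∧card≤⇒≡ (in-face i wᵢ∉e) (ℕ.≤-reflexive (trans (faces≡k i) (sym e≡k)))
    where
    not-all : ¬ (∀ i → w i ∈ e)
    not-all w∈e = ℕ.1+n≰n (begin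
      suc k           ≡⟨ w≡ ⟨
      card (span w)   ≤⟨ Subset.p⊆q⇒∣p∣≤∣q∣ (span-⊆ w w∈e) ⟩
      card e          ≡⟨ e≡k ⟩
      k               ∎)
      where open ℕ.≤-Reasoning
    in-face : ∀ i → w i ∉ e → e ⊆ span (face i)
    in-face i wᵢ∉e x∈e with ∈-span⁻ w (e⊆ x∈e)
    ... | j , refl = ∈-face (λ { refl → wᵢ∉e x∈e })

-- If `w 0F` equalled another vertex, a face containing both would span at most two vertices. So
-- `w 0F` lies outside the three-element face opposite to it.
card-span≡ : ∀ {n} (w : Fin 4 → Fin n) → (∀ i → card (span (face w i)) ≡ 3) → card (span w) ≡ 4
card-span≡ w faces≡3 = ℕ.≤-antisym (card-span≤ w)
  (subst (ℕ._< card (span w)) (faces≡3 0F) (Subset.p⊂q⇒∣p∣<∣q∣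
    (face-⊆ w 0F , w 0F , ∈-span⁺ w 0F , λ w₀∈ → let j , w₀≡ = ∈-span⁻ (face w 0F) w₀∈ in repeated j w₀≡)))
  where
  degenerate : ∀ i (v : Fin 2) → face w i 0F ≢ face w i (suc v)
  degenerate i v eq = ℕ.1+n≰n (begin
    3                                   ≡⟨ faces≡3 i ⟨
    card (span (face w i))              ≤⟨ Subset.p⊆q⇒∣p∣≤∣q∣ (span-⊆ (face w i) rest) ⟩
    card (span (face w i ∘ suc))        ≤⟨ card-span≤ (face w i ∘ suc) ⟩
    2                                   ∎)
    where
    open ℕ.≤-Reasoning
    rest : ∀ j → face w i j ∈ span (face w i ∘ suc)
    rest zero    = subst (_∈ span (face w i ∘ suc)) (sym eq) (∈-span⁺ (face w i ∘ suc) v)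
    rest (suc j) = ∈-span⁺ (face w i ∘ suc) j
  -- Some face contains both of two given vertices.
  repeated : ∀ j → w 0F ≢ w (suc j)
  repeated 0F = degenerate 2F 0F
  repeated 1F = degenerate 1F 0F
  repeated 2F = degenerate 1F 1F

-- Equivalence of the two problems.

module _ {n} (H : Hypergraph₃ n) where

  isEdge≡edge-span : ∀ x → isEdge H x ≡ edge H (span x)
  isEdge≡edge-span x = cong (λ p → edge H (⁅ x 0F ⁆ ∪ ⁅ x 1F ⁆ ∪ p)) (sym (Subset.∪-identityʳ ⁅ x 2F ⁆))

  isEdge-cong : ∀ x y → (∀ v → x v ≡ y v) → isEdge H x ≡ isEdge H y
  isEdge-cong x y x≗y = cong (edge H) (cong₂ _∪_ (cong ⁅_⁆ (x≗y 0F))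
    (cong₂ _∪_ (cong ⁅_⁆ (x≗y 1F)) (cong ⁅_⁆ (x≗y 2F))))

  -- Distinctness of the four vertices is not assumed: `uniform` gives each face three elements, and
  -- `card-span≡` does the rest.
  faces⇒hyperclique : ∀ w → (∀ i → isEdge H (face w i) ≡ true) → Problem.Yes (Hyperclique 4) H
  faces⇒hyperclique w edges = span w , w≡4 , λ e e⊆ e≡3 →
    let i , e≡face = subset-is-face w e⊆ e≡3 faces≡3 w≡4
    in trans (cong (edge H) e≡face) (edges′ i)
    where
    edges′ : ∀ i → edge H (span (face w i)) ≡ true
    edges′ i = trans (sym (isEdge≡edge-span (face w i))) (edges i)
    faces≡3 : ∀ i → card (span (face w i)) ≡ 3
    faces≡3 i = uniform H _ (edges′ i)
    w≡4 = card-span≡ w faces≡3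

  hyperclique⇒faces : Problem.Yes (Hyperclique 4) H → ∃[ w ] (∀ i → isEdge H (face w i) ≡ true)
  hyperclique⇒faces (S , S≡4 , clique) with card≡⇒span S S≡4
  ... | w , refl = w , λ i → trans (isEdge≡edge-span (face w i))
    (clique _ (face-⊆ w i) (card-face w S≡4 i))

  consistent⇒faces : ∀ (x : Fin 4 → Fin 3 → Fin n) → (∀ m → uncurry x (plus m) ≡ uncurry x (minus m)) →
                     ∃[ w ] (∀ i v → x i v ≡ face w i v)
  consistent⇒faces x c = w , go
    where
    w : Fin 4 → Fin n
    -- The triple of set 0 misses group 0, so that vertex is taken from set 1; the other three come
    -- from set 0.
    w 0F = x 1F 0F
    w (suc v) = x 0F v
    go : ∀ i v → x i v ≡ face w i v
    go 0F v  = refl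
    go 1F 0F = refl
    go 1F 1F = sym (c 4F)
    go 1F 2F = sym (c 6F)
    go 2F 0F = sym (c 0F)
    go 2F 1F = sym (c 2F)
    go 2F 2F = trans (sym (c 7F)) (sym (c 6F))
    go 3F 0F = trans (sym (c 1F)) (sym (c 0F))
    go 3F 1F = trans (sym (c 3F)) (sym (c 2F))
    go 3F 2F = trans (sym (c 5F)) (sym (c 4F))

  faces⇒consistent : ∀ (x : Fin 4 → Fin 3 → Fin n) (w : Fin 4 → Fin n) → (∀ i v → x i v ≡ face w i v) →
                     ∀ m → uncurry x (plus m) ≡ uncurry x (minus m)
  faces⇒consistent x w x≗ m = trans (x≗ _ _) (trans (agrees m) (sym (x≗ _ _)))
    where
    -- Both sides compute to the same entry of `w`, which confirms that every column compares copies
    -- of a single group.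
    agrees : ∀ m → uncurry (face w) (plus m) ≡ uncurry (face w) (minus m)
    agrees 0F = refl
    agrees 1F = refl
    agrees 2F = refl
    agrees 3F = refl
    agrees 4F = refl
    agrees 5F = refl
    agrees 6F = refl
    agrees 7F = refl

  fourSum⇔hyperclique : Problem.Yes (FourSum 4) (fourSum H) ⇔ Problem.Yes (Hyperclique 4) H
  fourSum⇔hyperclique = mk⇔ to from
    where
    to : Problem.Yes (FourSum 4) (fourSum H) → Problem.Yes (Hyperclique 4) H
    to (j₁ , j₂ , j₃ , j₄ , sum≡0) =
      let edges , consistent = Σ₄-entry≡0⇒ x (isEdge H ∘ x) sum≡0
          w , x≗ = consistent⇒faces x consistent
      in faces⇒hyperclique w (λ i → trans (sym (isEdge-cong (x i) (face w i) (x≗ i))) (edges i))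
      where
      x : Fin 4 → Fin 3 → Fin n
      x i = coords n (lookup (j₁ ∷ j₂ ∷ j₃ ∷ j₄ ∷ []) i)
    from : Problem.Yes (Hyperclique 4) H → Problem.Yes (FourSum 4) (fourSum H)
    from clique =
      let w , edges = hyperclique⇒faces clique
          x = λ i → coords n (index (face w i))
          x≗ = λ i → coords-index n (face w i)
      in index (face w 0F) , index (face w 1F) , index (face w 2F) , index (face w 3F) ,
         Σ₄-entry≡0⇐ x (isEdge H ∘ x) (λ i → trans (isEdge-cong (x i) (face w i) (x≗ i)) (edges i))
           (faces⇒consistent x w x≗)

-- Transfer of running times and word sizes from N = n³ to n.

cube-^ : ∀ n p → (n * (n * n)) ^ p ≡ n ^ (3 * p)
cube-^ n p = trans (cong (λ m → (n * (n * m)) ^ p) (sym (ℕ.*-identityʳ n))) (ℕ.^-*-assoc n 3 p)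

^-distribʳ-* : ∀ m n o → (m * n) ^ o ≡ m ^ o * n ^ o
^-distribʳ-* m n zero    = refl
^-distribʳ-* m n (suc o) = trans (cong (m * n *_) (^-distribʳ-* m n o))
  (ℕ.[m*n]*[o*p]≡[m*o]*[n*p] m n (m ^ o) (n ^ o))

-- `TimeBound` depends on the fraction and not only on its value, so the exponents are related by
-- numerator and denominator. The slowdown `K` enters the constant raised to the denominator.
TimeBound-cube : ∀ {C K n t t′} r r′ → ↥ r′ ≡ + 3 ℤ.* ↥ r → ↧ₙ r′ ≡ ↧ₙ r → t′ ≤ K * t →
                 TimeBound C (n * (n * n)) r t → TimeBound (K ^ ↧ₙ r * C) n r′ t′
TimeBound-cube {C} {K} {n} {t} {t′} (mkℚᵘ (+ p) d) (mkℚᵘ _ _) num≡ refl t′≤ bound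
  -- Puts the numerator of the new exponent in the form that selects the nonnegative clause of
  -- `TimeBound`.
  with refl ← trans num≡ (sym (ℤ.pos-* 3 p)) = begin
  t′ ^ q                           ≤⟨ ℕ.^-monoˡ-≤ q t′≤ ⟩
  (K * t) ^ q                      ≡⟨ ^-distribʳ-* K t q ⟩
  K ^ q * t ^ q                    ≤⟨ ℕ.*-monoʳ-≤ (K ^ q) bound ⟩
  K ^ q * (C * (n * (n * n)) ^ p)  ≡⟨ ℕ.*-assoc (K ^ q) C _ ⟨
  K ^ q * C * (n * (n * n)) ^ p    ≡⟨ cong (K ^ q * C *_) (cube-^ n p) ⟩
  K ^ q * C * n ^ (3 * p)          ∎
  where open ℕ.≤-Reasoning
        q = suc d
TimeBound-cube {C} {K} {n} {t} {t′} (mkℚᵘ -[1+ p ] d) (mkℚᵘ _ _) refl refl t′≤ bound = begin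
  t′ ^ q * n ^ (3 * suc p)               ≡⟨ cong (t′ ^ q *_) (cube-^ n (suc p)) ⟨
  t′ ^ q * (n * (n * n)) ^ suc p         ≤⟨ ℕ.*-monoˡ-≤ _ (ℕ.^-monoˡ-≤ q t′≤) ⟩
  (K * t) ^ q * (n * (n * n)) ^ suc p    ≡⟨ cong (_* (n * (n * n)) ^ suc p) (^-distribʳ-* K t q) ⟩
  K ^ q * t ^ q * (n * (n * n)) ^ suc p  ≡⟨ ℕ.*-assoc (K ^ q) _ _ ⟩
  K ^ q * (t ^ q * (n * (n * n)) ^ suc p) ≤⟨ ℕ.*-monoʳ-≤ (K ^ q) bound ⟩
  K ^ q * C                              ∎
  where open ℕ.≤-Reasoning
        q = suc d

-- Turns the word limit `(N + 2) ^ d` into `(n + 2) ^ (3 * d)`.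
cube+2≤ : ∀ n → n * (n * n) + 2 ≤ (n + 2) ^ 3
cube+2≤ n = begin
  n * (n * n) + 2 * 1        ≤⟨ ℕ.+-mono-≤ (ℕ.*-monoʳ-≤ n n²≤) (ℕ.*-monoʳ-≤ 2 1≤) ⟩
  n * b ^ 2 + 2 * b ^ 2      ≡⟨ ℕ.*-distribʳ-+ (b ^ 2) n 2 ⟨
  b ^ 3                      ∎
  where
  open ℕ.≤-Reasoning
  b = n + 2
  n≤ : n ≤ b
  n≤ = ℕ.m≤m+n n 2
  n²≤ : n * n ≤ b ^ 2
  n²≤ = ℕ.*-mono-≤ n≤ (ℕ.≤-trans n≤ (ℕ.≤-reflexive (sym (ℕ.*-identityʳ b))))
  1≤ : 1 ≤ b ^ 2
  1≤ = ℕ.m^n>0 b {{ℕ.>-nonZero (ℕ.≤-trans (s≤s z≤n) (ℕ.m≤n+m 2 n))}} 2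

-- Lets the threshold `n₀` be kept unchanged.
n≤cube : ∀ n → n ≤ n * (n * n)
n≤cube zero      = z≤n
n≤cube n@(suc _) = ℕ.m≤m*n n (n * n)

hyperclique-solvable : ∀ r r′ → ↥ r′ ≡ + 3 ℤ.* ↥ r → ↧ₙ r′ ≡ ↧ₙ r →
                       Solvable (FourSum 4) r → Solvable (Hyperclique 4) r′
hyperclique-solvable r r′ num≡ den≡ (p , d , C , n₀ , solve) =
  simulate cellE p ⨾ move 0 (width cellE) , D + degree D cellE , K ^ ↧ₙ r * C , n₀ , solve′
  where
  D = 3 * d
  K = cost cellE + 2 + 2
  solve′ : ∀ n (H : Hypergraph₃ n) → Σ[ t ∈ ℕ ] Σ[ σ ∈ State ]
    Run ((n + 2) ^ (D + degree D cellE)) (encodeHypergraph H)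
        (simulate cellE p ⨾ move 0 (width cellE)) initial t σ
    × (regs σ 0 ≡ 1ℤ ⇔ Problem.Yes (Hyperclique 4) H)
    × (n₀ ≤ n → TimeBound (K ^ ↧ₙ r * C) n r′ t)
  solve′ n H =
    let t , σ , run , correct , fast = solve (n * (n * n)) (fourSum H)
        t′ , τ , run′ , t′≤ , output≡ = accept-run (n + 2) (ℕ.m≤n+m 2 n) (encodeHypergraph-bounded H)
          cellE (value-cellE H) D words≤ run
        open Equivalence
    in t′ , τ , run′ ,
       mk⇔ (λ yes → to (fourSum⇔hyperclique H) (to correct (trans (sym output≡) yes)))
           (λ clique → trans output≡ (from correct (from (fourSum⇔hyperclique H) clique))) ,
       λ n₀≤n → TimeBound-cube {C} {K} r r′ num≡ den≡ t′≤ (fast (ℕ.≤-trans n₀≤n (n≤cube n)))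
    where
    words≤ : (n * (n * n) + 2) ^ d ≤ (n + 2) ^ D
    words≤ = ℕ.≤-trans (ℕ.^-monoˡ-≤ d (cube+2≤ n)) (ℕ.≤-reflexive (ℕ.^-*-assoc (n + 2) 3 d))

theorem6 : (∃[ ε ] 0ℚᵘ < ε × (∀ c → Solvable (FourSum c) (+ 4 / 3 - ε))) →
    ¬ HypercliqueHypothesis
theorem6 (ε@(mkℚᵘ +[1+ p ] d) , _ , solvable) hypothesis =
  hypothesis 4 ℕ.≤-refl ε′ (ℚ.positive⁻¹ ε′)
    (hyperclique-solvable (+ 4 / 3 - ε) (+ 4 / 1 - ε′) num≡ den≡ (solvable 4))
  where
  -- ε′ = 3 ε, with a denominator that makes 4 - ε′ = 3 (4/3 - ε) hold
  -- on numerators, without rescaling the exponents.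
  ε′ : ℚᵘ
  ε′ = mkℚᵘ (+ (9 * suc p)) (d + 2 * suc d)
  den≡ : ↧ₙ (+ 4 / 1 - ε′) ≡ ↧ₙ (+ 4 / 3 - ε)
  den≡ = ℕ.*-identityˡ (3 * suc d)
  num≡ : ↥ (+ 4 / 1 - ε′) ≡ + 3 ℤ.* ↥ (+ 4 / 3 - ε)
  num≡ = trans (cong₂ (λ x y → + 4 ℤ.* x ℤ.+ ℤ.- y ℤ.* + 1) (ℤ.pos-* 3 (suc d)) (ℤ.pos-* 9 (suc p)))
               (triple (+ suc d) (+ suc p))
    where
    triple : ∀ x y → + 4 ℤ.* (+ 3 ℤ.* x) ℤ.+ ℤ.- (+ 9 ℤ.* y) ℤ.* + 1
                     ≡ + 3 ℤ.* (+ 4 ℤ.* x ℤ.+ ℤ.- y ℤ.* + 3)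
    triple = solve-∀
theorem6 (mkℚᵘ (+ zero) d , *<* (ℤ.+<+ ()) , _)
theorem6 (mkℚᵘ -[1+ p ] d , *<* () , _)
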